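{- There exists an algorithm that, given $0<\varepsilon<1$ and access to a finite undirected graph $G=(V,E)$ with at least one edge through (1) random vertex queries, (2) random edge queries, and (3) degree queries, returns with probability at least $2/3$ a value $\hat d$ with $(1-\varepsilon)d\le\hat d\le(1+\varepsilon)d$, where $d=2m/n$ is the average degree, $n=|V|$, $m=|E|$. The algorithm performs $$O\left(\frac{m\log\log d}{n'\varepsilon^2}+\frac{n}{n'\varepsilon^2}\right)$$ queries in expectation (with an absolute implied constant), where $n'$ is the number of non-isolated vertices of $G$.
   Context: A random vertex query returns an independent uniformly random element of $V$; a random edge query returns an independent uniformly random element of $E$ (with its two endpoints); a degree query takes $v\in V$ and returns its degree $\deg(v)$. The algorithm is randomized, may be adaptive, and is not given $n$, $m$ or $n'$. A vertex is isolated if its degree is $0$. The expression $\log\log d$ (base-2 logarithms) is interpreted as $0$ when $d\le2$. -}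

module Defs where

open import Data.Bool.Base using (Bool; T; if_then_else_)
open import Data.Integer.Base using (+_)
import Data.Integer.Base as ℤ
open import Data.List.Base using (List; []; _∷_; length; map; foldr; filter)
open import Data.List.Membership.Propositional using (_∈_)
open import Data.List.Membership.Propositional.Properties using (∈-filter⁺)
open import Data.List.NonEmpty.Base using (List⁺; toList)
open import Data.List.Relation.Unary.All as All using (All)
open import Data.List.Relation.Unary.Any using (here; there)
open import Data.List.Relation.Unary.Unique.Propositional using (Unique)
open import Data.Nat.Base as ℕ using (ℕ; zero; suc)
import Data.Nat.Properties as ℕₚ
open import Data.Product.Base using (Σ; ∃; _×_; _,_; proj₁; proj₂; uncurry)
open import Data.Rational.Base
  using (ℚ; 0ℚ; 1ℚ; _+_; _-_; _*_; _÷_; _/_; ∣_∣; _≤_; _<_; Positive; ↥_; ↧ₙ_)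
open import Data.Rational.Properties using (+-*-rawSemiring; pos⇒nonZero)
open import Data.Sum.Base using (_⊎_; inj₁; inj₂)
open import Relation.Binary.PropositionalEquality.Core using (_≡_; refl)
open import Relation.Nullary.Decidable.Core using (Dec; _⊎-dec_)

open import Algebra.Definitions.RawSemiring +-*-rawSemiring using (_^_)

-- Bishop's regular sequences: the real x denoted by the sequence satisfies
-- |approx i - x| ≤ 1/(i+1) for every i.
record ℝ : Set where
  field
    approx  : ℕ → ℚ
    regular : ∀ i j → ∣ approx i - approx j ∣ ≤ + 1 / suc i + + 1 / suc j

open ℝ public

infix 4 _<ᴿ_ _ᴿ<_ _≤ᴿ_ _ᴿ≤_

-- Comparisons between a real and a rational; ᴿ is on the side of the real.
_<ᴿ_ : ℚ → ℝ → Set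
q <ᴿ x = ∃ λ i → q + + 1 / suc i < approx x i

_ᴿ<_ : ℝ → ℚ → Set
x ᴿ< q = ∃ λ i → approx x i + + 1 / suc i < q

_≤ᴿ_ : ℚ → ℝ → Set
q ≤ᴿ x = ∀ i → q ≤ approx x i + + 1 / suc i

_ᴿ≤_ : ℝ → ℚ → Set
x ᴿ≤ q = ∀ i → approx x i ≤ q + + 1 / suc i

2ℚ : ℚ
2ℚ = + 2 / 1

-- For x ≥ 0 and r = a/b ≥ 0, the inequalities x ≤ 2^r and 2^r ≤ x are
-- x^b ≤ 2^a and 2^a ≤ x^b.
_≤2^_ : ℚ → ℚ → Set
x ≤2^ r = x ^ (↧ₙ r) ≤ 2ℚ ^ ℤ.∣ ↥ r ∣

2^_≤_ : ℚ → ℚ → Set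
2^ r ≤ x = 2ℚ ^ ℤ.∣ ↥ r ∣ ≤ x ^ (↧ₙ r)

-- log log d ≤ s.  When d > 2, log log d > 0 and log d > 1, so for s ≥ 0 this
-- says log d ≤ 2^s, i.e. log d ≤ r for every rational r ≥ 2^s.  When d ≤ 2,
-- log log d is read as 0.
loglog_≤_ : ℚ → ℚ → Set
loglog d ≤ s = 0ℚ ≤ s × (2ℚ < d → ∀ r → 0ℚ ≤ r → 2^ s ≤ r → d ≤2^ r)

-- A finite simple graph whose vertices are named by arbitrary natural numbers.
-- The unordered pair {u , v}, u ≢ v, is represented by (u , v) with u < v.
record Graph : Set where
  field
    V        : List ℕ
    V-unique : Unique V
    E        : List (ℕ × ℕ)
    E-unique : Unique E
    E-valid  : All (λ (u , v) → u ℕ.< v × u ∈ V × v ∈ V) E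

  incident? : ∀ v (e : ℕ × ℕ) → Dec (v ≡ proj₁ e ⊎ v ≡ proj₂ e)
  incident? v (u , w) = (v ℕₚ.≟ u) ⊎-dec (v ℕₚ.≟ w)

  deg : ℕ → ℕ
  deg v = length (filter (incident? v) E)

  nonIsolated : List ℕ
  nonIsolated = filter (λ v → 0 ℕₚ.<? deg v) V

  n m n′ : ℕ
  n  = length V
  m  = length E
  n′ = length nonIsolated

open Graph public using (n; m; n′)

private
  ∈⇒nonZero : {A : Set} {x : A} {xs : List A} → x ∈ xs → ℕ.NonZero (length xs)
  ∈⇒nonZero (here _)  = _
  ∈⇒nonZero (there _) = _

  someEdge : {A : Set} (xs : List A) → .(ℕ.NonZero (length xs)) → ∃ λ x → x ∈ xs
  someEdge (x ∷ _) _ = x , here refl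

module _ (G : Graph) (m≢0 : ℕ.NonZero (m G)) where
  open Graph G using (V; E; E-valid; incident?; deg)

  n-nonZero : ℕ.NonZero (n G)
  n-nonZero with someEdge E m≢0
  ... | e , e∈E = ∈⇒nonZero (proj₁ (proj₂ (All.lookup E-valid e∈E)))

  n′-nonZero : ℕ.NonZero (n′ G)
  n′-nonZero with someEdge E m≢0
  ... | (u , w) , e∈E =
    ∈⇒nonZero (∈-filter⁺ (λ v → 0 ℕₚ.<? deg v) u∈V
      (ℕ.>-nonZero⁻¹ (deg u) ⦃ ∈⇒nonZero (∈-filter⁺ (incident? u) e∈E (inj₁ refl)) ⦄))
    where u∈V = proj₁ (proj₂ (All.lookup E-valid e∈E))

  averageDegree : ℚ
  averageDegree = _/_ (+ (2 ℕ.* m G)) (n G) ⦃ n-nonZero ⦄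

  -- C (m s / (n′ q²) + n / (n′ q²))
  queryBound : (C : ℕ) (s q : ℚ) → Positive q → ℚ
  queryBound C s q q>0 = (+ C / 1) * ((m/n′ * s) ÷ q ÷ q + n/n′ ÷ q ÷ q)
    where
    instance
      _ = n′-nonZero
      _ = pos⇒nonZero q ⦃ q>0 ⦄
    m/n′ = + m G / n′ G
    n/n′ = + n G / n′ G

-- `seen` lists the vertices returned by the queries made so far; only their
-- degrees may be asked for, so that degree queries are always at vertices of
-- the (unknown) graph.
data Action (S : List ℕ → Set) (seen : List ℕ) : Set where
  return      : ℚ → Action S seen
  vertexQuery : ((v : ℕ) → S (v ∷ seen)) → Action S seen
  edgeQuery   : ((u v : ℕ) → S (u ∷ v ∷ seen)) → Action S seen
  degreeQuery : (v : ℕ) → v ∈ seen → ((k : ℕ) → S seen) → Action S seen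

-- The next action is chosen uniformly from the list `step s`, with fresh
-- internal randomness.  States may record the whole history, so the algorithm
-- is adaptive; it need not halt on every run.
record Algorithm : Set₁ where
  field
    State : List ℕ → Set
    start : State []
    step  : ∀ {seen} → State seen → List⁺ (Action State seen)

-- Expectation of f at a uniformly random entry of a nonempty list.
mean : {A : Set} → (A → ℚ) → List A → ℚ
mean f []           = 0ℚ
mean f xs@(_ ∷ xs′) = (+ 1 / suc (length xs′)) * foldr _+_ 0ℚ (map f xs)

module Run (G : Graph) (A : Algorithm) where
  open Graph G using (V; E; deg)
  open Algorithm A

  -- The probability of returning, within t steps, a value x with good x ≡ true.
  mutual
    prob : (good : ℚ → Bool) (t : ℕ) → ∀ {seen} → State seen → ℚ
    prob good zero    s = 0ℚ
    prob good (suc t) s = mean (probAfter good t) (toList (step s))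

    probAfter : (good : ℚ → Bool) (t : ℕ) → ∀ {seen} → Action State seen → ℚ
    probAfter good t (return x)          = if good x then 1ℚ else 0ℚ
    probAfter good t (vertexQuery k)     = mean (λ v → prob good t (k v)) V
    probAfter good t (edgeQuery k)       = mean (λ e → prob good t (uncurry k e)) E
    probAfter good t (degreeQuery v _ k) = prob good t (k (deg v))

  -- The expected number of queries among the first t steps.
  mutual
    queries : (t : ℕ) → ∀ {seen} → State seen → ℚ
    queries zero    s = 0ℚ
    queries (suc t) s = mean (queriesFrom t) (toList (step s))

    queriesFrom : (t : ℕ) → ∀ {seen} → Action State seen → ℚ
    queriesFrom t (return x)          = 0ℚ
    queriesFrom t (vertexQuery k)     = 1ℚ + mean (λ v → queries t (k v)) V
    queriesFrom t (edgeQuery k)       = 1ℚ + mean (λ e → queries t (uncurry k e)) E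
    queriesFrom t (degreeQuery v _ k) = 1ℚ + queries t (k (deg v))

  -- With probability at least p the returned value satisfies P: the limit in t
  -- of the (nondecreasing) probabilities is at least p.  Comparisons with a real
  -- are not decidable, so P is measured through a decidable event contained in
  -- it; if P is itself decidable, that event may be taken to be P.
  ReturnsWithProbability≥ : ℚ → (ℚ → Set) → Set
  ReturnsWithProbability≥ p P =
    Σ (ℚ → Bool) λ good →
      (∀ x → T (good x) → P x) ×
      (∀ δ → 0ℚ < δ → ∃ λ t → p - δ ≤ prob good t start)

  -- The expectation is the supremum over t, by monotone convergence.
  ExpectedQueries≤ : ℚ → Set
  ExpectedQueries≤ B = ∀ t → queries t start ≤ B

open Run public using (ReturnsWithProbability≥; ExpectedQueries≤)

-- (1 - ε) d ≤ x ≤ (1 + ε) d for d ≥ 0, through the rational upper bounds of ε.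
Approximates : ℝ → ℚ → ℚ → Set
Approximates ε d x = ∀ q → ε ᴿ≤ q → (1ℚ - q) * d ≤ x × x ≤ (1ℚ + q) * d

{-# OPTIONS --safe #-}

-- The degree D of a random endpoint of a random edge has E[1/D] = n′/(2m) =: p₂,
-- and a random vertex is non-isolated with probability p₁ := n′/n, so that
-- d = p₁/p₂.  Both probabilities can be realised as coins, and counting the
-- trials N₁, N₂ that each coin takes to produce k = Θ(1/ε²) successes gives the
-- estimate N₂/N₁ with O(k/p₁ + k/p₂) = O((n + m)/(n′ε²)) expected queries.  The
-- extra factor log log d is free: if d < 3 then m = O(n), else log log d ≥ ½.
--
-- With r successes missing after N trials, (p N + r − k)² + r is a
-- supermartingale; it bounds the final value of (p N − k)², as in Chebyshev's
-- inequality.  Adding the expected remaining running time gives one potential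
-- function for both the success probability and the number of queries.

module Submission where

open import Data.Bool.Base using (Bool; true; false; if_then_else_; T)
open import Data.Integer.Base using (+_; -[1+_])
import Data.Integer.Base as ℤ
import Data.Integer.Properties as ℤₚ
open import Data.List.Base using (List; []; _∷_; length; map; foldr; filter; replicate)
open import Data.List.Properties using (length-filter; length-replicate)
open import Data.List.Membership.Propositional using (_∈_)
open import Data.List.NonEmpty.Base using (toList) renaming (_∷_ to _∷⁺_)
open import Data.List.Relation.Unary.All as All using (All; []; _∷_)
open import Data.List.Relation.Unary.AllPairs using ([]; _∷_)
open import Data.List.Relation.Unary.Any using (here; there)
open import Data.List.Relation.Unary.Unique.Propositional using (Unique)
open import Data.Nat.Base as ℕ using (ℕ; zero; suc; NonZero)
import Data.Nat.Properties as ℕₚ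
open import Data.Product.Base using (Σ; ∃; _×_; _,_; proj₁; proj₂; uncurry)
open import Data.Rational.Base
  using (ℚ; 0ℚ; 1ℚ; ½; _+_; _-_; _*_; -_; 1/_; _/_; _≤_; _<_; ∣_∣; ↥_; ↧ₙ_; mkℚ; *<*;
         Positive; positive; nonNegative; toℚᵘ)
open import Data.Rational.Properties
import Data.Rational.Unnormalised.Base as ℚᵘ
import Data.Rational.Unnormalised.Properties as ℚᵘₚ
open import Data.Sum.Base using (_⊎_; inj₁; inj₂)
open import Level using (0ℓ)
open import Relation.Binary.PropositionalEquality
open import Relation.Nullary.Decidable
  using (Dec; yes; no; does; ⌊_⌋; _⊎-dec_; _×-dec_; decidable-stable; dec⇒maybe; dec-true; dec-false)
open import Relation.Nullary.Negation.Core using (¬_; contradiction)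
open import Relation.Unary using (Pred; Decidable)
open import Tactic.RingSolver using (solve-∀)
open import Tactic.RingSolver.Core.AlmostCommutativeRing
  using (AlmostCommutativeRing; fromCommutativeRing)
open import Algebra.Definitions.RawSemiring +-*-rawSemiring using (_^_)
open import Defs

-- Rational arithmetic

ℚ-ring : AlmostCommutativeRing 0ℓ 0ℓ
ℚ-ring = fromCommutativeRing +-*-commutativeRing λ x → dec⇒maybe (0ℚ ≟ x)

ι : ℕ → ℚ
ι n = + n / 1

/-* : ∀ a b c d .{{_ : NonZero b}} .{{_ : NonZero d}} →
  (a / b) * (c / d) ≡ ((a ℤ.* c) / (b ℕ.* d)) {{ℕₚ.m*n≢0 b d}}
/-* a b@(suc _) c d@(suc _) = toℚᵘ-injective (begin
  toℚᵘ (a / b * (c / d))              ≈⟨ toℚᵘ-homo-* (a / b) (c / d) ⟩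
  toℚᵘ (a / b) ℚᵘ.* toℚᵘ (c / d)      ≈⟨ ℚᵘₚ.*-cong (toℚᵘ-fromℚᵘ (a ℚᵘ./ b)) (toℚᵘ-fromℚᵘ (c ℚᵘ./ d)) ⟩
  (a ℤ.* c) ℚᵘ./ (b ℕ.* d)            ≈⟨ toℚᵘ-fromℚᵘ ((a ℤ.* c) ℚᵘ./ (b ℕ.* d)) ⟨
  toℚᵘ ((a ℤ.* c) / (b ℕ.* d))        ∎)
  where open ℚᵘₚ.≃-Reasoning

/-≡ : ∀ a b c d .{{_ : NonZero b}} .{{_ : NonZero d}} →
  a ℤ.* + d ≡ c ℤ.* + b → a / b ≡ c / d
/-≡ a b@(suc _) c d@(suc _) eq = fromℚᵘ-cong {a ℚᵘ./ b} {c ℚᵘ./ d} (ℚᵘ.*≡* eq)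

/-*-ι : ∀ a b .{{_ : NonZero b}} → (+ a / b) * ι b ≡ ι a
/-*-ι a b@(suc _) = trans (/-* (+ a) b (+ b) 1)
  (/-≡ (+ a ℤ.* + b) (b ℕ.* 1) (+ a) 1 (begin
    + a ℤ.* + b ℤ.* + 1  ≡⟨ ℤₚ.*-assoc (+ a) (+ b) (+ 1) ⟩
    + a ℤ.* (+ b ℤ.* + 1) ≡⟨ cong (+ a ℤ.*_) (ℤₚ.pos-* b 1) ⟨
    + a ℤ.* + (b ℕ.* 1) ∎))
  where open ≡-Reasoning

ι-suc : ∀ n → ι (suc n) ≡ 1ℚ + ι n
ι-suc n = toℚᵘ-injective (begin
  toℚᵘ (ι (suc n))       ≈⟨ toℚᵘ-fromℚᵘ (+ suc n ℚᵘ./ 1) ⟩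
  + suc n ℚᵘ./ 1         ≈⟨ ℚᵘ.*≡* (cong (λ k → (+ 1 ℤ.+ k) ℤ.* + 1) (sym (ℤₚ.*-identityʳ (+ n)))) ⟩
  ℚᵘ.1ℚᵘ ℚᵘ.+ + n ℚᵘ./ 1 ≈⟨ ℚᵘₚ.+-cong (ℚᵘₚ.≃-refl {ℚᵘ.1ℚᵘ}) (toℚᵘ-fromℚᵘ (+ n ℚᵘ./ 1)) ⟨
  ℚᵘ.1ℚᵘ ℚᵘ.+ toℚᵘ (ι n) ≈⟨ toℚᵘ-homo-+ 1ℚ (ι n) ⟨
  toℚᵘ (1ℚ + ι n)        ∎)
  where open ℚᵘₚ.≃-Reasoning

ι-+ : ∀ m n → ι (m ℕ.+ n) ≡ ι m + ι n
ι-+ zero    n = sym (+-identityˡ (ι n))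
ι-+ (suc m) n = begin
  ι (suc (m ℕ.+ n))   ≡⟨ ι-suc (m ℕ.+ n) ⟩
  1ℚ + ι (m ℕ.+ n)    ≡⟨ cong (λ x → 1ℚ + x) (ι-+ m n) ⟩
  1ℚ + (ι m + ι n)    ≡⟨ +-assoc 1ℚ (ι m) (ι n) ⟨
  1ℚ + ι m + ι n      ≡⟨ cong (_+ ι n) (ι-suc m) ⟨
  ι (suc m) + ι n     ∎
  where open ≡-Reasoning

ι-* : ∀ m n → ι (m ℕ.* n) ≡ ι m * ι n
ι-* m n = trans (cong (_/ 1) (ℤₚ.pos-* m n)) (sym (/-* (+ m) 1 (+ n) 1))

0≤a/b : ∀ a b .{{_ : NonZero b}} → 0ℚ ≤ + a / b
0≤a/b a b = nonNegative⁻¹ (+ a / b) {{normalize-nonNeg a b}}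

0≤ι : ∀ n → 0ℚ ≤ ι n
0≤ι n = 0≤a/b n 1

0≤1 : 0ℚ ≤ 1ℚ
0≤1 = 0≤ι 1

0<ι : ∀ n .{{_ : NonZero n}} → 0ℚ < ι n
0<ι n = positive⁻¹ (ι n) {{normalize-pos n 1}}

1≤ι : ∀ n .{{_ : NonZero n}} → 1ℚ ≤ ι n
1≤ι (suc n) = subst₂ _≤_ (+-identityʳ 1ℚ) (sym (ι-suc n)) (+-monoʳ-≤ 1ℚ (0≤ι n))

ι-mono : ∀ {m n} → m ℕ.≤ n → ι m ≤ ι n
ι-mono {m} {n} m≤n = begin
  ι m               ≡⟨ +-identityʳ (ι m) ⟨
  ι m + 0ℚ          ≤⟨ +-monoʳ-≤ (ι m) (0≤ι (n ℕ.∸ m)) ⟩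
  ι m + ι (n ℕ.∸ m) ≡⟨ ι-+ m (n ℕ.∸ m) ⟨
  ι (m ℕ.+ (n ℕ.∸ m)) ≡⟨ cong ι (ℕₚ.m+[n∸m]≡n m≤n) ⟩
  ι n               ∎
  where open ≤-Reasoning

infixl 6 _⟨+⟩_
infixl 7 _⟨*⟩_

_⟨+⟩_ : ∀ {x y} → 0ℚ ≤ x → 0ℚ ≤ y → 0ℚ ≤ x + y
_⟨+⟩_ = +-mono-≤

_⟨*⟩_ : ∀ {x y} → 0ℚ ≤ x → 0ℚ ≤ y → 0ℚ ≤ x * y
_⟨*⟩_ {x} {y} 0≤x 0≤y = nonNegative⁻¹ (x * y)
  {{nonNeg*nonNeg⇒nonNeg x {{nonNegative 0≤x}} y {{nonNegative 0≤y}}}}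

≤⇒0≤- : ∀ {p q} → p ≤ q → 0ℚ ≤ q - p
≤⇒0≤- {p} {q} p≤q = subst (_≤ q - p) (+-inverseʳ p) (+-monoˡ-≤ (- p) p≤q)

-- Most inequalities below are proved by naming the slack `e`, which leaves an identity for the ring
-- solver.
≤-from : ∀ {p q e} → 0ℚ ≤ e → q ≡ p + e → p ≤ q
≤-from {p} {q} {e} 0≤e eq = begin
  p      ≡⟨ +-identityʳ p ⟨
  p + 0ℚ ≤⟨ +-monoʳ-≤ p 0≤e ⟩
  p + e  ≡⟨ eq ⟨
  q      ∎
  where open ≤-Reasoning

0≤sq : ∀ x → 0ℚ ≤ x * x
0≤sq x with ≤-total 0ℚ x
... | inj₁ 0≤x = 0≤x ⟨*⟩ 0≤x
... | inj₂ x≤0 = subst (0ℚ ≤_) (lem x) (0≤-x ⟨*⟩ 0≤-x)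
  where
  0≤-x = ≤⇒0≤- x≤0
  lem : ∀ x → (0ℚ - x) * (0ℚ - x) ≡ x * x
  lem = solve-∀ ℚ-ring

*-cancelˡ-0≤ : ∀ {k x} → 0ℚ < k → 0ℚ ≤ k * x → 0ℚ ≤ x
*-cancelˡ-0≤ {k} {x} 0<k 0≤kx = *-cancelˡ-≤-pos k {{positive 0<k}}
  (subst (_≤ k * x) (sym (*-zeroʳ k)) 0≤kx)

0≤-⇒≤ : ∀ {p q} → 0ℚ ≤ q - p → p ≤ q
0≤-⇒≤ {p} {q} 0≤q-p = ≤-from 0≤q-p (lem p q)
  where
  lem : ∀ p q → q ≡ p + (q - p)
  lem = solve-∀ ℚ-ring

*-cancelˡ-pos : ∀ {k x y} → 0ℚ < k → k * x ≡ k * y → x ≡ y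
*-cancelˡ-pos {k} 0<k eq = ≤-antisym (cancel (≤-reflexive eq)) (cancel (≤-reflexive (sym eq)))
  where
  cancel : ∀ {x y} → k * x ≤ k * y → x ≤ y
  cancel = *-cancelˡ-≤-pos k {{positive 0<k}}

-- Sums and means over lists

private variable
  X Y : Set

sum : (X → ℚ) → List X → ℚ
sum f xs = foldr _+_ 0ℚ (map f xs)

sum-mono : ∀ {f g : X → ℚ} → (∀ x → f x ≤ g x) → ∀ xs → sum f xs ≤ sum g xs
sum-mono f≤g []       = ≤-refl
sum-mono f≤g (x ∷ xs) = +-mono-≤ (f≤g x) (sum-mono f≤g xs)

sum-cong : ∀ {f g : X → ℚ} xs → All (λ x → f x ≡ g x) xs → sum f xs ≡ sum g xs
sum-cong []       []         = refl
sum-cong (x ∷ xs) (eq ∷ eqs) = cong₂ _+_ eq (sum-cong xs eqs)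

sum-+ : ∀ (f g : X → ℚ) xs → sum (λ x → f x + g x) xs ≡ sum f xs + sum g xs
sum-+ f g []       = refl
sum-+ f g (x ∷ xs) = trans (cong (λ z → (f x + g x) + z) (sum-+ f g xs)) (lem (f x) (g x) (sum f xs) (sum g xs))
  where
  lem : ∀ a b s t → a + b + (s + t) ≡ a + s + (b + t)
  lem = solve-∀ ℚ-ring

sum-*ʳ : ∀ b (f : X → ℚ) xs → sum (λ x → f x * b) xs ≡ sum f xs * b
sum-*ʳ b f []       = sym (*-zeroˡ b)
sum-*ʳ b f (x ∷ xs) = trans (cong (λ z → f x * b + z) (sum-*ʳ b f xs)) (sym (*-distribʳ-+ b (f x) (sum f xs)))

sum-const : ∀ a (xs : List X) → sum (λ _ → a) xs ≡ ι (length xs) * a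
sum-const a []       = sym (*-zeroˡ a)
sum-const a (_ ∷ xs) = begin
  a + sum (λ _ → a) xs       ≡⟨ cong (λ z → a + z) (sum-const a xs) ⟩
  a + ι (length xs) * a      ≡⟨ lem a (ι (length xs)) ⟩
  (1ℚ + ι (length xs)) * a   ≡⟨ cong (_* a) (ι-suc (length xs)) ⟨
  ι (suc (length xs)) * a    ∎
  where
  open ≡-Reasoning
  lem : ∀ a l → a + l * a ≡ (1ℚ + l) * a
  lem = solve-∀ ℚ-ring

sum-0 : ∀ (xs : List X) → sum (λ _ → 0ℚ) xs ≡ 0ℚ
sum-0 xs = trans (sum-const 0ℚ xs) (*-zeroʳ (ι (length xs)))

sum-swap : ∀ (f : X → Y → ℚ) xs ys →
  sum (λ x → sum (f x) ys) xs ≡ sum (λ y → sum (λ x → f x y) xs) ys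
sum-swap f []       ys = sym (sum-0 ys)
sum-swap f (x ∷ xs) ys = trans (cong (λ z → sum (f x) ys + z) (sum-swap f xs ys))
  (sym (sum-+ (f x) (λ y → sum (λ x → f x y) xs) ys))

length*mean : ∀ (f : X → ℚ) xs → ι (length xs) * mean f xs ≡ sum f xs
length*mean f []           = refl
length*mean f xs@(_ ∷ xs′) = begin
  ι l * ((+ 1 / l) * sum f xs) ≡⟨ *-assoc (ι l) (+ 1 / l) (sum f xs) ⟨
  ι l * (+ 1 / l) * sum f xs   ≡⟨ cong (_* sum f xs) (trans (*-comm (ι l) (+ 1 / l)) (/-*-ι 1 l)) ⟩
  1ℚ * sum f xs                ≡⟨ *-identityˡ (sum f xs) ⟩
  sum f xs                     ∎
  where
  open ≡-Reasoning
  l = suc (length xs′)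

mean-mono : ∀ {f g : X → ℚ} → (∀ x → f x ≤ g x) → ∀ xs → mean f xs ≤ mean g xs
mean-mono f≤g []           = ≤-refl
mean-mono f≤g xs@(_ ∷ xs′) = *-monoˡ-≤-nonNeg (+ 1 / suc (length xs′)) {{normalize-nonNeg 1 (suc (length xs′))}}
  (sum-mono f≤g xs)

mean-linear : ∀ b (f g : X → ℚ) xs → mean (λ x → f x + g x * b) xs ≡ mean f xs + mean g xs * b
mean-linear b f g []           = sym (trans (+-identityˡ (0ℚ * b)) (*-zeroˡ b))
mean-linear b f g xs@(_ ∷ xs′) = begin
  h * sum (λ x → f x + g x * b) xs   ≡⟨ cong (h *_) (sum-+ f (λ x → g x * b) xs) ⟩
  h * (sum f xs + sum (λ x → g x * b) xs) ≡⟨ cong (λ z → h * (sum f xs + z)) (sum-*ʳ b g xs) ⟩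
  h * (sum f xs + sum g xs * b)      ≡⟨ lem h (sum f xs) (sum g xs) b ⟩
  h * sum f xs + h * sum g xs * b    ∎
  where
  open ≡-Reasoning
  h = + 1 / suc (length xs′)
  lem : ∀ h s t b → h * (s + t * b) ≡ h * s + h * t * b
  lem = solve-∀ ℚ-ring

mean-const : ∀ a (xs : List X) → .{{NonZero (length xs)}} → mean (λ _ → a) xs ≡ a
mean-const a xs@(_ ∷ xs′) = begin
  (+ 1 / l) * sum (λ _ → a) xs   ≡⟨ cong ((+ 1 / l) *_) (sum-const a xs) ⟩
  (+ 1 / l) * (ι l * a)          ≡⟨ *-assoc (+ 1 / l) (ι l) a ⟨
  (+ 1 / l) * ι l * a            ≡⟨ cong (_* a) (/-*-ι 1 l) ⟩
  1ℚ * a                         ≡⟨ *-identityˡ a ⟩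
  a                              ∎
  where
  open ≡-Reasoning
  l = suc (length xs′)

mean-affine : ∀ a b (f : X → ℚ) xs → .{{NonZero (length xs)}} →
  mean (λ x → a + f x * b) xs ≡ a + mean f xs * b
mean-affine a b f xs = trans (mean-linear b (λ _ → a) f xs)
  (cong (_+ mean f xs * b) (mean-const a xs))

mean-nonNeg : ∀ {f : X → ℚ} → (∀ x → 0ℚ ≤ f x) → ∀ xs → 0ℚ ≤ mean f xs
mean-nonNeg     0≤f []         = ≤-refl
mean-nonNeg {f = f} 0≤f xs@(_ ∷ _) = subst (_≤ mean f xs) (mean-const 0ℚ xs) (mean-mono 0≤f xs)

mean-[] : ∀ (f : X → ℚ) x → mean f (x ∷ []) ≡ f x
mean-[] f x = trans (*-identityˡ (f x + 0ℚ)) (+-identityʳ (f x))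

-- A coin of bias `1 / (j + 1)`, in the form "failure value plus bias times gain" used for all coins
-- below.
mean-replicate : ∀ (f : X → ℚ) x y j →
  mean f (x ∷ replicate j y) ≡ f y + (+ 1 / suc j) * (f x - f y)
mean-replicate f x y j = begin
  (+ 1 / suc (length (replicate j y))) * (f x + sum f (replicate j y))
    ≡⟨ cong₂ (λ l s → (+ 1 / suc l) * (f x + s)) (length-replicate j) (sum-replicate j) ⟩
  g * (f x + ι j * f y)                    ≡⟨ lem g (f x) (f y) (ι j) ⟩
  g * (1ℚ + ι j) * f y + g * (f x - f y)   ≡⟨ cong (λ z → g * z * f y + g * (f x - f y)) (ι-suc j) ⟨
  g * ι (suc j) * f y + g * (f x - f y)    ≡⟨ cong (λ z → z * f y + g * (f x - f y)) (/-*-ι 1 (suc j)) ⟩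
  1ℚ * f y + g * (f x - f y)               ≡⟨ cong (_+ g * (f x - f y)) (*-identityˡ (f y)) ⟩
  f y + g * (f x - f y)                    ∎
  where
  open ≡-Reasoning
  g = + 1 / suc j
  lem : ∀ g a b j → g * (a + j * b) ≡ g * (1ℚ + j) * b + g * (a - b)
  lem = solve-∀ ℚ-ring
  sum-replicate : ∀ j → sum f (replicate j y) ≡ ι j * f y
  sum-replicate zero    = sym (*-zeroˡ (f y))
  sum-replicate (suc j) = trans (cong (λ z → f y + z) (sum-replicate j))
    (trans (lem′ (f y) (ι j)) (cong (_* f y) (sym (ι-suc j))))
    where
    lem′ : ∀ b j → b + j * b ≡ (1ℚ + j) * b
    lem′ = solve-∀ ℚ-ring

𝟙 : ∀ {P : Set} → Dec P → ℚ
𝟙 P? = if does P? then 1ℚ else 0ℚ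

𝟙-yes : ∀ {P : Set} (P? : Dec P) → P → 𝟙 P? ≡ 1ℚ
𝟙-yes P? p = cong (if_then 1ℚ else 0ℚ) (dec-true P? p)

𝟙-no : ∀ {P : Set} (P? : Dec P) → ¬ P → 𝟙 P? ≡ 0ℚ
𝟙-no P? ¬p = cong (if_then 1ℚ else 0ℚ) (dec-false P? ¬p)

𝟙-⊎ : ∀ {P Q : Set} (P? : Dec P) (Q? : Dec Q) → (P → ¬ Q) → 𝟙 (P? ⊎-dec Q?) ≡ 𝟙 P? + 𝟙 Q?
𝟙-⊎ (yes p) (yes q) disjoint = contradiction q (disjoint p)
𝟙-⊎ (yes _) (no  _) _        = refl
𝟙-⊎ (no  _) (yes _) _        = refl
𝟙-⊎ (no  _) (no  _) _        = refl

sum-𝟙 : ∀ {P : Pred X 0ℓ} (P? : Decidable P) xs → sum (λ x → 𝟙 (P? x)) xs ≡ ι (length (filter P? xs))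
sum-𝟙 P? []       = refl
sum-𝟙 P? (x ∷ xs) with does (P? x)
... | true  = trans (cong (λ z → 1ℚ + z) (sum-𝟙 P? xs)) (sym (ι-suc (length (filter P? xs))))
... | false = trans (+-identityˡ _) (sum-𝟙 P? xs)

sum-point : ∀ (g : ℕ → ℚ) {u xs} → Unique xs → u ∈ xs →
  sum (λ v → 𝟙 (v ℕₚ.≟ u) * g v) xs ≡ g u
sum-point g {u} {x ∷ xs} (x∉xs ∷ _) (here refl) = begin
  𝟙 (u ℕₚ.≟ u) * g u + sum (λ v → 𝟙 (v ℕₚ.≟ u) * g v) xs
    ≡⟨ cong₂ _+_ (cong (_* g u) (𝟙-yes (u ℕₚ.≟ u) refl))
         (trans (sum-cong xs (All.map (λ {v} u≢v → cong (_* g v) (𝟙-no (v ℕₚ.≟ u) (λ v≡u → u≢v (sym v≡u)))) x∉xs))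
           (sum-cong xs (All.universal (λ v → *-zeroˡ (g v)) xs))) ⟩
  1ℚ * g u + sum (λ _ → 0ℚ) xs  ≡⟨ cong (λ z → 1ℚ * g u + z) (sum-0 xs) ⟩
  1ℚ * g u + 0ℚ                 ≡⟨ trans (+-identityʳ (1ℚ * g u)) (*-identityˡ (g u)) ⟩
  g u                           ∎
  where
  open ≡-Reasoning
sum-point g {u} {x ∷ xs} (x∉xs ∷ xs!) (there u∈xs) = begin
  𝟙 (x ℕₚ.≟ u) * g x + sum (λ v → 𝟙 (v ℕₚ.≟ u) * g v) xs
    ≡⟨ cong₂ _+_ (cong (_* g x) (𝟙-no (x ℕₚ.≟ u) (All.lookup x∉xs u∈xs))) (sum-point g xs! u∈xs) ⟩
  0ℚ * g x + g u  ≡⟨ cong (_+ g u) (*-zeroˡ (g x)) ⟩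
  0ℚ + g u        ≡⟨ +-identityˡ (g u) ⟩
  g u             ∎
  where open ≡-Reasoning

-- Success probabilities of the two coins

-- 1/k, with the junk value coin 0 = 1: endpoints of edges have positive degree.
coin : ℕ → ℚ
coin k = + 1 / suc (ℕ.pred k)

-- A vertex of degree `k` is an endpoint `k` times, each time with weight `1 / k`, so every
-- non-isolated vertex counts once. At `k = 0` the first factor removes the junk value.
ι*coin : ∀ k → ι k * coin k ≡ 𝟙 (0 ℕₚ.<? k)
ι*coin zero    = refl
ι*coin (suc k) = trans (*-comm (ι (suc k)) (coin (suc k))) (/-*-ι 1 (suc k))

0≤coin : ∀ D → 0ℚ ≤ coin D
0≤coin D = 0≤a/b 1 (suc (ℕ.pred D))

coin≤1 : ∀ D → coin D ≤ 1ℚ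
coin≤1 D = ≤-from (0≤ι (ℕ.pred D) ⟨*⟩ 0≤coin D) (begin
  1ℚ                                ≡⟨ /-*-ι 1 (suc (ℕ.pred D)) ⟨
  coin D * ι (suc (ℕ.pred D))       ≡⟨ cong (coin D *_) (ι-suc (ℕ.pred D)) ⟩
  coin D * (1ℚ + ι (ℕ.pred D))      ≡⟨ lem (coin D) (ι (ℕ.pred D)) ⟩
  coin D + ι (ℕ.pred D) * coin D    ∎)
  where
  open ≡-Reasoning
  lem : ∀ g j → g * (1ℚ + j) ≡ g + j * g
  lem = solve-∀ ℚ-ring

module Sampling (G : Graph) (m≢0 : NonZero (m G)) where
  open Graph G using (V; E; V-unique; E-valid; incident?; deg)

  instance
    n-NonZero : NonZero (n G)
    n-NonZero = n-nonZero G m≢0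

    m-NonZero : NonZero (m G)
    m-NonZero = m≢0

    n′-NonZero : NonZero (n′ G)
    n′-NonZero = n′-nonZero G m≢0

    2m-NonZero : NonZero (2 ℕ.* m G)
    2m-NonZero = ℕₚ.m*n≢0 2 (m G)

  sum-incident : ∀ (g : ℕ → ℚ) {u w} → u ℕ.< w × u ∈ V × w ∈ V →
    sum (λ v → 𝟙 (incident? v (u , w)) * g v) V ≡ g u + g w
  sum-incident g {u} {w} (u<w , u∈V , w∈V) = begin
    sum (λ v → 𝟙 (incident? v (u , w)) * g v) V
      ≡⟨ sum-cong V (All.universal (λ v → split v) V) ⟩
    sum (λ v → 𝟙 (v ℕₚ.≟ u) * g v + 𝟙 (v ℕₚ.≟ w) * g v) V
      ≡⟨ sum-+ (λ v → 𝟙 (v ℕₚ.≟ u) * g v) (λ v → 𝟙 (v ℕₚ.≟ w) * g v) V ⟩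
    sum (λ v → 𝟙 (v ℕₚ.≟ u) * g v) V + sum (λ v → 𝟙 (v ℕₚ.≟ w) * g v) V
      ≡⟨ cong₂ _+_ (sum-point g V-unique u∈V) (sum-point g V-unique w∈V) ⟩
    g u + g w ∎
    where
    open ≡-Reasoning
    split : ∀ v → 𝟙 (incident? v (u , w)) * g v ≡ 𝟙 (v ℕₚ.≟ u) * g v + 𝟙 (v ℕₚ.≟ w) * g v
    -- `u < w` excludes loops, so at most one of the two indicators is 1.
    split v = trans (cong (_* g v) (𝟙-⊎ (v ℕₚ.≟ u) (v ℕₚ.≟ w)
      λ { refl refl → ℕₚ.<-irrefl refl u<w })) (*-distribʳ-+ (g v) (𝟙 (v ℕₚ.≟ u)) (𝟙 (v ℕₚ.≟ w)))

  -- Double counting of incidences between vertices and edges, weighted by `g`; the usual handshake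
  -- lemma is `g = 1`.
  handshake : ∀ (g : ℕ → ℚ) → sum (λ (u , w) → g u + g w) E ≡ sum (λ v → ι (deg v) * g v) V
  handshake g = begin
    sum (λ (u , w) → g u + g w) E
      ≡⟨ sum-cong E (All.map (λ valid → sym (sum-incident g valid)) E-valid) ⟩
    sum (λ e → sum (λ v → 𝟙 (incident? v e) * g v) V) E
      ≡⟨ sum-swap (λ e v → 𝟙 (incident? v e) * g v) E V ⟩
    sum (λ v → sum (λ e → 𝟙 (incident? v e) * g v) E) V
      ≡⟨ sum-cong V (All.universal (λ v → trans (sum-*ʳ (g v) (λ e → 𝟙 (incident? v e)) E)
           (cong (_* g v) (sum-𝟙 (incident? v) E))) V) ⟩
    sum (λ v → ι (deg v) * g v) V ∎
    where open ≡-Reasoning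

  -- The probabilities are kept as means, as the drift computation meets them; their reciprocals
  -- `c₁`, `c₂` are fractions over `n′`, as in the query bound.
  p₁ p₂ c₁ c₂ : ℚ
  p₁ = mean (λ v → 𝟙 (0 ℕₚ.<? deg v)) V
  p₂ = mean (λ (u , w) → coin (deg u) + coin (deg w)) E * ½
  c₁ = + n G / n′ G
  c₂ = + (2 ℕ.* m G) / n′ G

  n*p₁ : ι (n G) * p₁ ≡ ι (n′ G)
  n*p₁ = trans (length*mean (λ v → 𝟙 (0 ℕₚ.<? deg v)) V) (sum-𝟙 (λ v → 0 ℕₚ.<? deg v) V)

  2m*p₂ : ι (2 ℕ.* m G) * p₂ ≡ ι (n′ G)
  2m*p₂ = begin
    ι (2 ℕ.* m G) * (M * ½)           ≡⟨ cong (_* (M * ½)) (ι-* 2 (m G)) ⟩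
    ι 2 * ι (m G) * (M * ½)           ≡⟨ lem (ι (m G)) M ⟩
    ι (m G) * M                       ≡⟨ length*mean _ E ⟩
    sum (λ (u , w) → coin (deg u) + coin (deg w)) E
                                      ≡⟨ handshake (λ v → coin (deg v)) ⟩
    sum (λ v → ι (deg v) * coin (deg v)) V
                                      ≡⟨ sum-cong V (All.universal (λ v → ι*coin (deg v)) V) ⟩
    sum (λ v → 𝟙 (0 ℕₚ.<? deg v)) V   ≡⟨ sum-𝟙 (λ v → 0 ℕₚ.<? deg v) V ⟩
    ι (n′ G)                          ∎
    where
    open ≡-Reasoning
    M = mean (λ (u , w) → coin (deg u) + coin (deg w)) E
    lem : ∀ m M → (+ 2 / 1) * m * (M * ½) ≡ m * M
    lem = solve-∀ ℚ-ring

  private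
    reciprocal : ∀ a p .{{_ : NonZero a}} → ι a * p ≡ ι (n′ G) → p * (+ a / n′ G) ≡ 1ℚ
    reciprocal a p eq = *-cancelˡ-pos (0<ι a) (begin
      ι a * (p * (+ a / n′ G))      ≡⟨ *-assoc (ι a) p (+ a / n′ G) ⟨
      ι a * p * (+ a / n′ G)        ≡⟨ cong (_* (+ a / n′ G)) eq ⟩
      ι (n′ G) * (+ a / n′ G)       ≡⟨ *-comm (ι (n′ G)) (+ a / n′ G) ⟩
      (+ a / n′ G) * ι (n′ G)       ≡⟨ /-*-ι a (n′ G) ⟩
      ι a                           ≡⟨ *-identityʳ (ι a) ⟨
      ι a * 1ℚ                      ∎)
      where open ≡-Reasoning

  p₁*c₁ : p₁ * c₁ ≡ 1ℚ
  p₁*c₁ = reciprocal (n G) p₁ n*p₁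

  p₂*c₂ : p₂ * c₂ ≡ 1ℚ
  p₂*c₂ = reciprocal (2 ℕ.* m G) p₂ 2m*p₂

  -- Multiplied by `n`, both sides equal `n′`.
  d*p₂ : averageDegree G m≢0 * p₂ ≡ p₁
  d*p₂ = *-cancelˡ-pos (0<ι (n G)) (begin
    ι (n G) * (d * p₂)   ≡⟨ *-assoc (ι (n G)) d p₂ ⟨
    ι (n G) * d * p₂     ≡⟨ cong (_* p₂) (trans (*-comm (ι (n G)) d) (/-*-ι (2 ℕ.* m G) (n G))) ⟩
    ι (2 ℕ.* m G) * p₂   ≡⟨ trans 2m*p₂ (sym n*p₁) ⟩
    ι (n G) * p₁         ∎)
    where
    open ≡-Reasoning
    d = averageDegree G m≢0

  -- Lets `start-cost≤` absorb the additive 1 of the starting cost.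
  c₁≥1 : 1ℚ ≤ c₁
  c₁≥1 = 0≤-⇒≤ (*-cancelˡ-0≤ (0<ι (n′ G)) (subst (0ℚ ≤_) lem (≤⇒0≤- (ι-mono n′≤n))))
    where
    n′≤n : n′ G ℕ.≤ n G
    n′≤n = length-filter (λ v → 0 ℕₚ.<? deg v) V
    lem₁ : ∀ c k → c * k - k ≡ k * (c - 1ℚ)
    lem₁ = solve-∀ ℚ-ring
    lem : ι (n G) - ι (n′ G) ≡ ι (n′ G) * (c₁ - 1ℚ)
    lem = trans (cong (_- ι (n′ G)) (sym (/-*-ι (n G) (n′ G)))) (lem₁ c₁ (ι (n′ G)))

  0<p₂ : 0ℚ < p₂
  0<p₂ = *-cancelˡ-<-nonNeg (ι (2 ℕ.* m G)) {{nonNegative (0≤ι (2 ℕ.* m G))}}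
    (subst₂ _<_ (sym (*-zeroʳ (ι (2 ℕ.* m G)))) (sym 2m*p₂) (0<ι (n′ G)))

-- Drift arguments

module Drift
  (G : Graph) (m≢0 : NonZero (m G)) (A : Algorithm)
  (good : ℚ → Bool) (B : ℕ)
  (potential : ∀ {seen} → Algorithm.State A seen → ℚ)
  where
  open Graph G using (V; E; deg)
  open Algorithm A
  open Run G A using (prob; probAfter; queries; queriesFrom)

  -- A bad answer is charged `B`, so that the potential also controls the failure probability.
  after : ∀ {seen} → Action State seen → ℚ
  after (return x)          = if good x then 0ℚ else ι B
  after (vertexQuery k)     = mean (λ v → potential (k v)) V
  after (edgeQuery k)       = mean (λ e → potential (uncurry k e)) E
  after (degreeQuery v _ k) = potential (k (deg v))

  module _
    (potential-nonNeg : ∀ {seen} (s : State seen) → 0ℚ ≤ potential s)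
    (drift : ∀ {seen} (s : State seen) → 1ℚ + mean after (toList (step s)) ≤ potential s)
    where

    mutual
      -- The `1ℚ` in `drift` pays for one step, and a step makes at most one query.
      queries≤ : ∀ t {seen} (s : State seen) → queries t s ≤ potential s
      queries≤ zero    s = potential-nonNeg s
      queries≤ (suc t) s = begin
        mean (queriesFrom t) as           ≤⟨ mean-mono (queriesFrom≤ t) as ⟩
        mean (λ a → 1ℚ + after a * 1ℚ) as ≡⟨ mean-affine 1ℚ 1ℚ after as ⟩
        1ℚ + mean after as * 1ℚ           ≡⟨ cong (λ z → 1ℚ + z) (*-identityʳ (mean after as)) ⟩
        1ℚ + mean after as                ≤⟨ drift s ⟩
        potential s                       ∎
        where
        open ≤-Reasoning
        as = toList (step s)

      queriesFrom≤ : ∀ t {seen} (a : Action State seen) → queriesFrom t a ≤ 1ℚ + after a * 1ℚ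
      queriesFrom≤ t a = subst (λ z → queriesFrom t a ≤ 1ℚ + z) (sym (*-identityʳ (after a))) (lem a)
        where
        lem : ∀ {seen} (a : Action State seen) → queriesFrom t a ≤ 1ℚ + after a
        lem (return x) with good x
        ... | true  = 0≤1 ⟨+⟩ ≤-refl
        ... | false = 0≤1 ⟨+⟩ 0≤ι B
        lem (vertexQuery k)     = +-monoʳ-≤ 1ℚ (mean-mono (λ v → queries≤ t (k v)) V)
        lem (edgeQuery k)       = +-monoʳ-≤ 1ℚ (mean-mono (λ e → queries≤ t (uncurry k e)) E)
        lem (degreeQuery v _ k) = +-monoʳ-≤ 1ℚ (queries≤ t (k (deg v)))

    -- Markov's inequality for the running time is built in: the time elapsed
    -- plus the potential is a supermartingale, which is at least B both when
    -- B steps have passed and when a bad value has been returned.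
    mutual
      prob≥ : ∀ t {seen} (s : State seen) → t ℕ.≤ B → ι t ≤ potential s + prob good t s * ι B
      prob≥ zero    s _   = potential-nonNeg s ⟨+⟩ (≤-refl {0ℚ} ⟨*⟩ 0≤ι B)
      prob≥ (suc t) s t<B = begin
        ι (suc t)                                 ≡⟨ ι-suc t ⟩
        1ℚ + ι t                                  ≡⟨ cong (λ z → 1ℚ + z) (mean-const (ι t) as) ⟨
        1ℚ + mean (λ _ → ι t) as
          ≤⟨ +-monoʳ-≤ 1ℚ (mean-mono (λ a → probAfter≥ t a (ℕₚ.<⇒≤ t<B)) as) ⟩
        1ℚ + mean (λ a → after a + probAfter good t a * ι B) as
          ≡⟨ cong (λ z → 1ℚ + z) (mean-linear (ι B) after (probAfter good t) as) ⟩
        1ℚ + (mean after as + mean (probAfter good t) as * ι B)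
          ≡⟨ +-assoc 1ℚ (mean after as) (mean (probAfter good t) as * ι B) ⟨
        1ℚ + mean after as + mean (probAfter good t) as * ι B
          ≤⟨ +-monoˡ-≤ (mean (probAfter good t) as * ι B) (drift s) ⟩
        potential s + mean (probAfter good t) as * ι B ∎
        where
        open ≤-Reasoning
        as = toList (step s)

      probAfter≥ : ∀ t {seen} (a : Action State seen) → t ℕ.≤ B →
        ι t ≤ after a + probAfter good t a * ι B
      probAfter≥ t (return x) t≤B with good x
      ... | true  = subst (ι t ≤_) (lem (ι B)) (ι-mono t≤B)
        where
        lem : ∀ b → b ≡ 0ℚ + 1ℚ * b
        lem = solve-∀ ℚ-ring
      ... | false = subst (ι t ≤_) (lem (ι B)) (ι-mono t≤B)
        where
        lem : ∀ b → b ≡ b + 0ℚ * b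
        lem = solve-∀ ℚ-ring
      probAfter≥ t (vertexQuery k)     t≤B = mean≥ t V {{n-nonZero G m≢0}} (λ v → prob≥ t (k v) t≤B)
      probAfter≥ t (edgeQuery k)       t≤B = mean≥ t E {{m≢0}} (λ e → prob≥ t (uncurry k e) t≤B)
      probAfter≥ t (degreeQuery v _ k) t≤B = prob≥ t (k (deg v)) t≤B

      private
        mean≥ : ∀ t {X : Set} (xs : List X) .{{_ : NonZero (length xs)}} {f g : X → ℚ} →
          (∀ x → ι t ≤ f x + g x * ι B) → ι t ≤ mean f xs + mean g xs * ι B
        mean≥ t xs {f} {g} bound = begin
          ι t                             ≡⟨ mean-const (ι t) xs ⟨
          mean (λ _ → ι t) xs             ≤⟨ mean-mono bound xs ⟩
          mean (λ x → f x + g x * ι B) xs ≡⟨ mean-linear (ι B) f g xs ⟩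
          mean f xs + mean g xs * ι B     ∎
          where open ≤-Reasoning

-- The algorithm and its potential

-- r is the number of successes that are still missing in the current phase, or
-- that will be missing if the trial in progress succeeds; N₁ and N₂ count the
-- completed trials of the two phases.
data State : List ℕ → Set where
  vertexTrial    : ∀ {seen} (r N₁ : ℕ) → State seen
  vertexDrawn    : ∀ {seen} (r N₁ v : ℕ) → v ∈ seen → State seen
  edgeDrawn      : ∀ {seen} (r N₁ N₂ u w : ℕ) → u ∈ seen → w ∈ seen → State seen
  endpointDegree : ∀ {seen} (r N₁ N₂ D : ℕ) → State seen

-- The value at `N₁ = 0` is a default; `close-ratio` shows that `N₁ = 0` always comes with a large
-- deviation.
ratio : ℕ → ℕ → ℚ
ratio N₂ zero        = 0ℚ
ratio N₂ N₁@(suc _)  = + N₂ / N₁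

-- An action rather than a state: the coin flip of one trial and the edge query of the next share a
-- step, so a trial takes two steps.
edgeTrial : ∀ {seen} (r N₁ N₂ : ℕ) → Action State seen
edgeTrial zero    N₁ N₂ = return (ratio N₂ N₁)
edgeTrial (suc r) N₁ N₂ = edgeQuery λ u w → edgeDrawn r N₁ N₂ u w (here refl) (there (here refl))

afterDegree : ∀ {seen} (r N₁ D : ℕ) → State seen
afterDegree r N₁ zero    = vertexTrial (suc r) (suc N₁)
afterDegree r N₁ (suc _) = vertexTrial r (suc N₁)

-- In the last state one of D equally likely actions counts as a success.
ratioEstimator : ℕ → Algorithm
ratioEstimator k = record
  { State = State
  ; start = vertexTrial k 0
  ; step  = λ where
      (vertexTrial zero N₁)        → edgeTrial k N₁ 0 ∷⁺ []
      (vertexTrial (suc r) N₁)     → vertexQuery (λ v → vertexDrawn r N₁ v (here refl)) ∷⁺ []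
      (vertexDrawn r N₁ v v∈)      → degreeQuery v v∈ (afterDegree r N₁) ∷⁺ []
      -- The uniform choice between two degree queries draws the random endpoint; it is the factor
      -- `½` in `p₂`.
      (edgeDrawn r N₁ N₂ u w u∈ w∈) →
        degreeQuery u u∈ (endpointDegree r N₁ N₂) ∷⁺ (degreeQuery w w∈ (endpointDegree r N₁ N₂) ∷ [])
      (endpointDegree r N₁ N₂ D)   →
        edgeTrial r N₁ (suc N₂) ∷⁺ replicate (ℕ.pred D) (edgeTrial (suc r) N₁ (suc N₂))
  }

-- `y + g * (x - y)` is the mixture of `x` and `y` with weights `g` and `1 - g`, both nonnegative.
mix-mono : ∀ {g x x′ y y′} → 0ℚ ≤ g → g ≤ 1ℚ → x ≤ x′ → y ≤ y′ →
  y + g * (x - y) ≤ y′ + g * (x′ - y′)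
mix-mono {g} {x} {x′} {y} {y′} 0≤g g≤1 x≤x′ y≤y′ =
  ≤-from (≤⇒0≤- g≤1 ⟨*⟩ ≤⇒0≤- y≤y′ ⟨+⟩ 0≤g ⟨*⟩ ≤⇒0≤- x≤x′) (lem g x x′ y y′)
  where
  lem : ∀ g x x′ y y′ →
    y′ + g * (x′ - y′) ≡ y + g * (x - y) + ((1ℚ - g) * (y′ - y) + g * (x′ - x))
  lem = solve-∀ ℚ-ring

-- With r of k successes missing after N trials of success probability p = 1/c,
-- each taking two steps: the expected number of remaining steps, plus the
-- expected final value of w (p N − k)² up to the factor 1 − p of its variance.
opaque
  phase : (w k p c : ℚ) (r N : ℕ) → ℚ
  phase w k p c r N = w * (dev * dev + ι r) + ι 2 * (ι r * c)
    where
    dev : ℚ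
    dev = p * ι N + ι r - k

  phase-nonNeg : ∀ {w} k p {c} → 0ℚ ≤ w → 0ℚ ≤ c → ∀ r N → 0ℚ ≤ phase w k p c r N
  phase-nonNeg k p 0≤w 0≤c r N =
    0≤w ⟨*⟩ (0≤sq (p * ι N + ι r - k) ⟨+⟩ 0≤ι r) ⟨+⟩ 0≤ι 2 ⟨*⟩ (0≤ι r ⟨*⟩ 0≤c)

  -- A failure changes the deviation by `p`, a success by `p - 1`: the mean change is 0 and the mean
  -- square `p (1 - p)`. The summand `ι r` loses `p` on average, so a surplus `w p²` remains. The
  -- time term loses `2 p c = 2`, which pays for the two steps.
  phase-drift : ∀ {w} k {p c} → 0ℚ ≤ w → p * c ≡ 1ℚ → ∀ r N →
    ι 2 + (phase w k p c (suc r) (suc N) + p * (phase w k p c r (suc N) - phase w k p c (suc r) (suc N)))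
      ≤ phase w k p c (suc r) N
  phase-drift {w} k {p} {c} 0≤w pc r N
    rewrite ι-suc r | ι-suc N =
    -- The equation `p c = 1` enters as a slack term that is in fact zero, since the ring solver
    -- takes no hypotheses.
    ≤-from (0≤w ⟨*⟩ 0≤sq p ⟨+⟩ 0≤ι 2 ⟨*⟩ ≤⇒0≤- (≤-reflexive (sym pc))) (lem w k p c (ι r) (ι N))
    where
    lem : ∀ w k p c r n →
      w * ((p * n + (1ℚ + r) - k) * (p * n + (1ℚ + r) - k) + (1ℚ + r)) + (+ 2 / 1) * ((1ℚ + r) * c) ≡
      (+ 2 / 1) + ((w * ((p * (1ℚ + n) + (1ℚ + r) - k) * (p * (1ℚ + n) + (1ℚ + r) - k) + (1ℚ + r)) + (+ 2 / 1) * ((1ℚ + r) * c))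
        + p * ((w * ((p * (1ℚ + n) + r - k) * (p * (1ℚ + n) + r - k) + r) + (+ 2 / 1) * (r * c))
          - (w * ((p * (1ℚ + n) + (1ℚ + r) - k) * (p * (1ℚ + n) + (1ℚ + r) - k) + (1ℚ + r)) + (+ 2 / 1) * ((1ℚ + r) * c))))
      + (w * (p * p) + (+ 2 / 1) * (p * c - 1ℚ))
    lem = solve-∀ ℚ-ring

opaque
  unfolding phase

  phase-end : ∀ w k p c N → phase w k p c 0 N ≡ w * ((p * ι N - k) * (p * ι N - k))
  phase-end w k p c N = lem w k p c (ι N)
    where
    lem : ∀ w k p c n → w * ((p * n + 0ℚ - k) * (p * n + 0ℚ - k) + 0ℚ) + (+ 2 / 1) * (0ℚ * c) ≡
      w * ((p * n - k) * (p * n - k))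
    lem = solve-∀ ℚ-ring

  -- At the start the deviation is 0; what remains is the variance bound `w k` and the expected time
  -- `2 k c`.
  phase-start : ∀ w p c k → phase w (ι k) p c k 0 ≡ w * ι k + ι 2 * (ι k * c)
  phase-start w p c k = lem w p c (ι k)
    where
    lem : ∀ w p c k → w * ((p * 0ℚ + k - k) * (p * 0ℚ + k - k) + k) + (+ 2 / 1) * (k * c) ≡
      w * k + (+ 2 / 1) * (k * c)
    lem = solve-∀ ℚ-ring

-- The potential of the estimator and its drift.

module Estimator (k : ℕ) (G : Graph) (m≢0 : NonZero (m G)) {w : ℚ} (0≤w : 0ℚ ≤ w) where
  open Graph G using (V; E; deg)
  open Sampling G m≢0
  open Algorithm (ratioEstimator k) using (step)

  Ψ₁ Ψ₂ : ℕ → ℕ → ℚ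
  Ψ₁ = phase w (ι k) p₁ c₁
  Ψ₂ = phase w (ι k) p₂ c₂

  0≤Ψ₁ : ∀ r N → 0ℚ ≤ Ψ₁ r N
  0≤Ψ₁ = phase-nonNeg (ι k) p₁ 0≤w (0≤a/b (n G) (n′ G))

  0≤Ψ₂ : ∀ r N → 0ℚ ≤ Ψ₂ r N
  0≤Ψ₂ = phase-nonNeg (ι k) p₂ 0≤w (0≤a/b (2 ℕ.* m G) (n′ G))

  -- The `1ℚ` pays for the step that `vertexTrial zero` takes into the second phase.
  trialΨ : ℕ → ℕ → ℚ
  trialΨ r N₁ = 1ℚ + (Ψ₁ r N₁ + Ψ₂ k 0)

  -- The deviation `Ψ₁ 0 N₁` of the finished first phase is carried along until a value is returned;
  -- the rest is the mixture over a coin of bias `coin D`.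
  endpointΨ : ℕ → ℕ → ℕ → ℕ → ℚ
  endpointΨ r N₁ N₂ D =
    1ℚ + (Ψ₁ 0 N₁ + (Ψ₂ (suc r) (suc N₂) + coin D * (Ψ₂ r (suc N₂) - Ψ₂ (suc r) (suc N₂))))

  potential : ∀ {seen} → State seen → ℚ
  potential (vertexTrial r N₁)          = trialΨ r N₁
  potential (vertexDrawn r N₁ v _)      =
    1ℚ + (trialΨ (suc r) (suc N₁) + 𝟙 (0 ℕₚ.<? deg v) * (Ψ₁ r (suc N₁) - Ψ₁ (suc r) (suc N₁)))
  potential (edgeDrawn r N₁ N₂ u w _ _) = 1ℚ + mean (λ v → endpointΨ r N₁ N₂ (deg v)) (u ∷ w ∷ [])
  potential (endpointDegree r N₁ N₂ D)  = endpointΨ r N₁ N₂ D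

  -- Written as an affine function of an indicator, whose average over `V` is `p₁`.
  potential-afterDegree : ∀ {seen} r N₁ D → potential {seen} (afterDegree r N₁ D) ≡
    trialΨ (suc r) (suc N₁) + 𝟙 (0 ℕₚ.<? D) * (Ψ₁ r (suc N₁) - Ψ₁ (suc r) (suc N₁))
  potential-afterDegree r N₁ zero    = lem (trialΨ (suc r) (suc N₁)) (Ψ₁ r (suc N₁) - Ψ₁ (suc r) (suc N₁))
    where
    lem : ∀ x y → x ≡ x + 0ℚ * y
    lem = solve-∀ ℚ-ring
  potential-afterDegree r N₁ (suc _) = lem (Ψ₁ r (suc N₁)) (Ψ₁ (suc r) (suc N₁)) (Ψ₂ k 0)
    where
    lem : ∀ x y z → 1ℚ + (x + z) ≡ 1ℚ + (y + z) + 1ℚ * (x - y)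
    lem = solve-∀ ℚ-ring

  0≤trialΨ : ∀ r N₁ → 0ℚ ≤ trialΨ r N₁
  0≤trialΨ r N₁ = 0≤1 ⟨+⟩ (0≤Ψ₁ r N₁ ⟨+⟩ 0≤Ψ₂ k 0)

  0≤endpointΨ : ∀ r N₁ N₂ D → 0ℚ ≤ endpointΨ r N₁ N₂ D
  0≤endpointΨ r N₁ N₂ D = 0≤1 ⟨+⟩ (0≤Ψ₁ 0 N₁ ⟨+⟩ subst (_≤ mixed) (lem (coin D))
    (mix-mono (0≤coin D) (coin≤1 D) (0≤Ψ₂ r (suc N₂)) (0≤Ψ₂ (suc r) (suc N₂))))
    where
    mixed = Ψ₂ (suc r) (suc N₂) + coin D * (Ψ₂ r (suc N₂) - Ψ₂ (suc r) (suc N₂))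
    lem : ∀ g → 0ℚ + g * (0ℚ - 0ℚ) ≡ 0ℚ
    lem = solve-∀ ℚ-ring

  potential-nonNeg : ∀ {seen} (s : State seen) → 0ℚ ≤ potential s
  potential-nonNeg (vertexTrial r N₁)            = 0≤trialΨ r N₁
  potential-nonNeg (vertexDrawn r N₁ v _)        =
    0≤1 ⟨+⟩ subst (0ℚ ≤_) (potential-afterDegree {[]} r N₁ (deg v)) (0≤afterDegree (deg v))
    where
    0≤afterDegree : ∀ D → 0ℚ ≤ potential {[]} (afterDegree r N₁ D)
    0≤afterDegree zero    = 0≤trialΨ (suc r) (suc N₁)
    0≤afterDegree (suc _) = 0≤trialΨ r (suc N₁)
  potential-nonNeg (edgeDrawn r N₁ N₂ u w _ _)   =
    0≤1 ⟨+⟩ mean-nonNeg (λ v → 0≤endpointΨ r N₁ N₂ (deg v)) (u ∷ w ∷ [])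
  potential-nonNeg (endpointDegree r N₁ N₂ D)    = 0≤endpointΨ r N₁ N₂ D

  module _
    (good : ℚ → Bool) (B : ℕ)
    (bad⇒deviation : ∀ N₁ N₂ → good (ratio N₂ N₁) ≡ false → ι B ≤ Ψ₁ 0 N₁ + Ψ₂ 0 N₂)
    where
    open Drift G m≢0 (ratioEstimator k) good B potential

    average-endpoints : ∀ r N₁ N₂ u w →
      1ℚ + mean (λ v → endpointΨ r N₁ N₂ (deg v)) (u ∷ w ∷ []) ≡
      ι 2 + (Ψ₁ 0 N₁ + Ψ₂ (suc r) (suc N₂)) +
      (coin (deg u) + coin (deg w)) * (½ * (Ψ₂ r (suc N₂) - Ψ₂ (suc r) (suc N₂)))
    average-endpoints r N₁ N₂ u w = lem (Ψ₁ 0 N₁) (Ψ₂ (suc r) (suc N₂))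
      (Ψ₂ r (suc N₂) - Ψ₂ (suc r) (suc N₂)) (coin (deg u)) (coin (deg w))
      where
      lem : ∀ z y b g h →
        1ℚ + (+ 1 / 2) * (1ℚ + (z + (y + g * b)) + (1ℚ + (z + (y + h * b)) + 0ℚ)) ≡
        (+ 2 / 1) + (z + y) + (g + h) * (½ * b)
      lem = solve-∀ ℚ-ring

    mean-coins : ∀ z y b → mean (λ (u , w) → ι 2 + (z + y) + (coin (deg u) + coin (deg w)) * (½ * b)) E ≡ z + (ι 2 + (y + p₂ * b))
    mean-coins z y b = trans (mean-affine (ι 2 + (z + y)) (½ * b) (λ (u , w) → coin (deg u) + coin (deg w)) E)
       (lem z y b M)
      where
      M = mean (λ (u , w) → coin (deg u) + coin (deg w)) E
      lem : ∀ z y b M → (+ 2 / 1) + (z + y) + M * (½ * b) ≡ z + ((+ 2 / 1) + (y + M * ½ * b))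
      lem = solve-∀ ℚ-ring

    -- The potential is affine in the coins of the two endpoints, so averaging over `E` gives a coin
    -- of bias `p₂`. The `ι 2` of `phase-drift` covers the degree query and the coin flip.
    mean-edgeDrawn : ∀ r N₁ N₂ → mean (λ (u , w) → 1ℚ + mean (λ v → endpointΨ r N₁ N₂ (deg v)) (u ∷ w ∷ [])) E ≤ Ψ₁ 0 N₁ + Ψ₂ (suc r) N₂
    mean-edgeDrawn r N₁ N₂ = begin
      mean (λ (u , w) → 1ℚ + mean (λ v → endpointΨ r N₁ N₂ (deg v)) (u ∷ w ∷ [])) E
        ≤⟨ mean-mono (λ (u , w) → ≤-reflexive (average-endpoints r N₁ N₂ u w)) E ⟩
      mean (λ (u , w) → ι 2 + (z + y) + (coin (deg u) + coin (deg w)) * (½ * b)) E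
        ≡⟨ mean-coins z y b ⟩
      z + (ι 2 + (y + p₂ * b))          ≤⟨ +-monoʳ-≤ z (phase-drift (ι k) 0≤w p₂*c₂ r N₂) ⟩
      z + Ψ₂ (suc r) N₂                    ∎
      where
      open ≤-Reasoning
      z = Ψ₁ 0 N₁
      y = Ψ₂ (suc r) (suc N₂)
      b = Ψ₂ r (suc N₂) - Ψ₂ (suc r) (suc N₂)

    after-edgeTrial : ∀ {seen} r N₁ N₂ → after {seen} (edgeTrial r N₁ N₂) ≤ Ψ₁ 0 N₁ + Ψ₂ r N₂
    after-edgeTrial zero    N₁ N₂ = after-return (good (ratio N₂ N₁)) refl
      where
      after-return : ∀ b → good (ratio N₂ N₁) ≡ b → (if b then 0ℚ else ι B) ≤ Ψ₁ 0 N₁ + Ψ₂ 0 N₂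
      after-return true  _  = 0≤Ψ₁ 0 N₁ ⟨+⟩ 0≤Ψ₂ 0 N₂
      after-return false eq = bad⇒deviation N₁ N₂ eq
    after-edgeTrial (suc r) N₁ N₂ = mean-edgeDrawn r N₁ N₂

    drift : ∀ {seen} (s : State seen) → 1ℚ + mean after (toList (step s)) ≤ potential s
    drift {seen} (vertexTrial zero N₁)         = +-monoʳ-≤ 1ℚ (begin
      mean after (edgeTrial k N₁ 0 ∷ [])   ≡⟨ mean-[] after (edgeTrial k N₁ 0) ⟩
      after {seen} (edgeTrial k N₁ 0)      ≤⟨ after-edgeTrial k N₁ 0 ⟩
      Ψ₁ 0 N₁ + Ψ₂ k 0                     ∎)
      where open ≤-Reasoning
    drift {seen} (vertexTrial (suc r) N₁)      = +-monoʳ-≤ 1ℚ (begin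
      mean after (vertexQuery draw ∷ [])
        ≡⟨ mean-[] after (vertexQuery draw) ⟩
      mean (λ v → 1ℚ + (trialΨ (suc r) (suc N₁) + 𝟙 (0 ℕₚ.<? deg v) * b)) V
        ≤⟨ mean-mono (λ v → ≤-reflexive (sym (+-assoc 1ℚ (trialΨ (suc r) (suc N₁)) (𝟙 (0 ℕₚ.<? deg v) * b)))) V ⟩
      mean (λ v → 1ℚ + trialΨ (suc r) (suc N₁) + 𝟙 (0 ℕₚ.<? deg v) * b) V
        ≡⟨ mean-affine (1ℚ + trialΨ (suc r) (suc N₁)) b (λ v → 𝟙 (0 ℕₚ.<? deg v)) V ⟩
      1ℚ + (1ℚ + (y + z)) + p₁ * b ≡⟨ lem y z (p₁ * b) ⟩
      ι 2 + (y + p₁ * b) + z       ≤⟨ +-monoˡ-≤ z (phase-drift (ι k) 0≤w p₁*c₁ r N₁) ⟩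
      Ψ₁ (suc r) N₁ + z            ∎)
      where
      open ≤-Reasoning
      draw : (v : ℕ) → State (v ∷ seen)
      draw v = vertexDrawn r N₁ v (here refl)
      y = Ψ₁ (suc r) (suc N₁)
      z = Ψ₂ k 0
      b = Ψ₁ r (suc N₁) - Ψ₁ (suc r) (suc N₁)
      lem : ∀ y z x → 1ℚ + (1ℚ + (y + z)) + x ≡ (+ 2 / 1) + (y + x) + z
      lem = solve-∀ ℚ-ring
    drift (vertexDrawn r N₁ v v∈)              = +-monoʳ-≤ 1ℚ (≤-reflexive
      (trans (mean-[] after (degreeQuery v v∈ (afterDegree r N₁))) (potential-afterDegree r N₁ (deg v))))
    drift (edgeDrawn r N₁ N₂ u w _ _)          = ≤-refl
    drift {seen} (endpointDegree r N₁ N₂ D)     = +-monoʳ-≤ 1ℚ (begin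
      mean after (edgeTrial r N₁ (suc N₂) ∷ replicate (ℕ.pred D) (edgeTrial (suc r) N₁ (suc N₂)))
        ≡⟨ mean-replicate after (edgeTrial r N₁ (suc N₂)) (edgeTrial (suc r) N₁ (suc N₂)) (ℕ.pred D) ⟩
      fail + coin D * (after (edgeTrial r N₁ (suc N₂)) - fail)
        ≤⟨ mix-mono (0≤coin D) (coin≤1 D) (after-edgeTrial {seen} r N₁ (suc N₂)) (after-edgeTrial {seen} (suc r) N₁ (suc N₂)) ⟩
      z + y + coin D * (z + x - (z + y))   ≡⟨ lem x y z (coin D) ⟩
      z + (y + coin D * (x - y))           ∎)
      where
      open ≤-Reasoning
      fail = after {seen} (edgeTrial (suc r) N₁ (suc N₂))
      x = Ψ₂ r (suc N₂)
      y = Ψ₂ (suc r) (suc N₂)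
      z = Ψ₁ 0 N₁
      lem : ∀ x y z g → z + y + g * (z + x - (z + y)) ≡ z + (y + g * (x - y))
      lem = solve-∀ ℚ-ring

-- Precision and log log

p≤∣p∣ : ∀ p → p ≤ ∣ p ∣
p≤∣p∣ p with ≤-total 0ℚ p
... | inj₁ 0≤p = ≤-reflexive (sym (0≤p⇒∣p∣≡p 0≤p))
... | inj₂ p≤0 = ≤-trans p≤0 (0≤∣p∣ p)

-- The denominator of `x` suffices, because the numerator is at least 1.
archimedean : ∀ x → 0ℚ < x → ∃ λ b → 1ℚ ≤ ι (suc b) * x
archimedean x@(mkℚ (ℤ.+_ zero) _ _)        0<x = contradiction refl (<⇒≢ (subst (0ℚ <_) (↥p≡0⇒p≡0 x refl) 0<x))
archimedean x@(mkℚ -[1+ _ ] _ _)          0<x = contradiction (<-trans 0<x (negative⁻¹ x)) (<-irrefl refl)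
archimedean x@(mkℚ (ℤ.+_ a@(suc _)) b _) _   = b , (begin
  1ℚ                        ≤⟨ 1≤ι a ⟩
  ι a                       ≡⟨ /-*-ι a (suc b) ⟨
  (+ a / suc b) * ι (suc b) ≡⟨ *-comm (+ a / suc b) (ι (suc b)) ⟩
  ι (suc b) * (+ a / suc b) ≡⟨ cong (ι (suc b) *_) (↥p/↧p≡p x) ⟩
  ι (suc b) * x             ∎)
  where open ≤-Reasoning

-- The least multiple reaching 1: the previous one is below 1 and `x ≤ 1`. The search descends from
-- the archimedean multiple.
multiple-in-[1,2] : ∀ x → 0ℚ < x → x ≤ 1ℚ → ∃ λ K → 1ℚ ≤ ι (suc K) * x × ι (suc K) * x ≤ ι 2
multiple-in-[1,2] x 0<x x≤1 = search (suc (proj₁ (archimedean x 0<x))) (proj₂ (archimedean x 0<x))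
  where
  search : ∀ b → 1ℚ ≤ ι b * x → ∃ λ K → 1ℚ ≤ ι (suc K) * x × ι (suc K) * x ≤ ι 2
  search zero    1≤0 = contradiction (<-≤-trans (0<ι 1) (≤-trans 1≤0 (≤-reflexive (*-zeroˡ x)))) (<-irrefl refl)
  search (suc b) 1≤  with 1ℚ ≤? ι b * x
  ... | yes 1≤b*x = search b 1≤b*x
  ... | no  1≰b*x = b , 1≤ , (begin
    ι (suc b) * x       ≡⟨ cong (_* x) (ι-suc b) ⟩
    (1ℚ + ι b) * x      ≡⟨ *-distribʳ-+ x 1ℚ (ι b) ⟩
    1ℚ * x + ι b * x    ≤⟨ +-mono-≤ (≤-trans (≤-reflexive (*-identityˡ x)) x≤1) (<⇒≤ (≰⇒> 1≰b*x)) ⟩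
    1ℚ + 1ℚ             ∎)
    where open ≤-Reasoning

-- Up to constant factors, 1 / suc K approximates ε from below.
calibrate : ∀ ε → 0ℚ <ᴿ ε → ε ᴿ< 1ℚ →
  ∃ λ K → (∀ q → ε ᴿ≤ q → 1ℚ ≤ ι (suc K) * q) × (∀ q → q ≤ᴿ ε → ι (suc K) * q ≤ ι 4)
calibrate ε (i , 0<ε) (i′ , ε<1) = K , lower , upper
  where
  open ≤-Reasoning
  r = + 1 / suc i
  r′ = + 1 / suc i′
  e = approx ε i - r

  0<e : 0ℚ < e
  0<e = subst (_< e) (lem r) (+-monoˡ-< (- r) 0<ε)
    where
    lem : ∀ r → 0ℚ + r - r ≡ 0ℚ
    lem = solve-∀ ℚ-ring

  b = proj₁ (archimedean e 0<e)
  -- Chosen so that `suc j` is `4 * suc b`, whence `4 h ≤ e`.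
  j = b ℕ.+ 3 ℕ.* suc b
  h = + 1 / suc j
  x = approx ε j

  0≤h : 0ℚ ≤ h
  0≤h = 0≤a/b 1 (suc j)

  0<h : 0ℚ < h
  0<h = positive⁻¹ h {{normalize-pos 1 (suc j)}}

  4h≤e : ι 4 * h ≤ e
  4h≤e = 0≤-⇒≤ (*-cancelˡ-0≤ (0<ι (suc b)) (subst (0ℚ ≤_) eq (≤⇒0≤- (proj₂ (archimedean e 0<e)))))
    where
    lem : ∀ b e h → b * e - h * ((+ 4 / 1) * b) ≡ b * (e - (+ 4 / 1) * h)
    lem = solve-∀ ℚ-ring
    eq : ι (suc b) * e - 1ℚ ≡ ι (suc b) * (e - ι 4 * h)
    eq = trans (cong (λ z → ι (suc b) * e - z) (trans (sym (/-*-ι 1 (suc j))) (cong (h *_) (ι-* 4 (suc b)))))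
      (lem (ι (suc b)) e h)

  -- Regularity puts `x` within `r + h` of `approx ε i`, so `x ≥ e - h ≥ 3 h`.
  3h≤x : ι 3 * h ≤ x
  3h≤x = ≤-from (≤⇒0≤- 4h≤e ⟨+⟩ ≤⇒0≤- (≤-trans (p≤∣p∣ (approx ε i - x)) (regular ε i j))) (lem (approx ε i) r h x)
    where
    lem : ∀ a r h x → x ≡ (+ 3 / 1) * h + ((a - r - (+ 4 / 1) * h) + (r + h - (a - x)))
    lem = solve-∀ ℚ-ring

  -- A lower bound of ε which, by `3 h ≤ x`, also satisfies `ε ≤ x + h ≤ 2 q₀`. A multiple of `q₀`
  -- in `[1, 2]` thus gives both bounds, with 4 in the upper one.
  q₀ = x - h

  0<q₀ : 0ℚ < q₀
  0<q₀ = <-≤-trans 0<h (≤-from (≤⇒0≤- 3h≤x ⟨+⟩ 0≤h) (lem x h))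
    where
    lem : ∀ x h → x - h ≡ h + (x - (+ 3 / 1) * h + h)
    lem = solve-∀ ℚ-ring

  q₀≤1 : q₀ ≤ 1ℚ
  q₀≤1 = ≤-from (≤⇒0≤- (<⇒≤ ε<1) ⟨+⟩ ≤⇒0≤- (≤-trans (p≤∣p∣ (x - approx ε i′)) (regular ε j i′))) (lem (approx ε i′) r′ h x)
    where
    lem : ∀ a r h x → 1ℚ ≡ x - h + ((1ℚ - (a + r)) + (h + r - (x - a)))
    lem = solve-∀ ℚ-ring

  K = proj₁ (multiple-in-[1,2] q₀ 0<q₀ q₀≤1)

  lower : ∀ q → ε ᴿ≤ q → 1ℚ ≤ ι (suc K) * q
  lower q ε≤q = ≤-trans (proj₁ (proj₂ (multiple-in-[1,2] q₀ 0<q₀ q₀≤1)))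
    (≤-from (0≤ι (suc K) ⟨*⟩ ≤⇒0≤- (ε≤q j)) (lem (ι (suc K)) x q h))
    where
    lem : ∀ k x q h → k * q ≡ k * (x - h) + k * (q + h - x)
    lem = solve-∀ ℚ-ring

  upper : ∀ q → q ≤ᴿ ε → ι (suc K) * q ≤ ι 4
  upper q q≤ε = ≤-from
    (0≤ι (suc K) ⟨*⟩ (≤⇒0≤- (q≤ε j) ⟨+⟩ ≤⇒0≤- 3h≤x) ⟨+⟩ 0≤ι 2 ⟨*⟩ ≤⇒0≤- (proj₂ (proj₂ (multiple-in-[1,2] q₀ 0<q₀ q₀≤1))))
    (lem (ι (suc K)) x q h)
    where
    lem : ∀ k x q h → (+ 4 / 1) ≡ k * q + (k * (x + h - q + (x - (+ 3 / 1) * h)) + (+ 2 / 1) * ((+ 2 / 1) - k * (x - h)))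
    lem = solve-∀ ℚ-ring

1≤x^ : ∀ {x} → 1ℚ ≤ x → ∀ b → 1ℚ ≤ x ^ b
1≤x^ 1≤x zero    = ≤-refl
1≤x^ {x} 1≤x (suc b) = ≤-from
  (≤⇒0≤- 1≤x ⟨+⟩ ≤-trans 0≤1 1≤x ⟨*⟩ ≤⇒0≤- (1≤x^ 1≤x b)) (lem x (x ^ b))
  where
  lem : ∀ x y → x * y ≡ 1ℚ + (x - 1ℚ + x * (y - 1ℚ))
  lem = solve-∀ ℚ-ring

-- Each factor 2 is matched by two factors `3/2`, since `9/4 ≥ 2`; the factors left over are at
-- least 1.
2^a≤3/2^b : ∀ a b → a ℕ.* 2 ℕ.≤ b → 2ℚ ^ a ≤ (+ 3 / 2) ^ b
2^a≤3/2^b zero    b             _                         = 1≤x^ (≤-from (0≤a/b 1 2) refl) b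
2^a≤3/2^b (suc a) (suc (suc b)) (ℕ.s≤s (ℕ.s≤s 2a≤b)) = ≤-from
  (0≤ι 2 ⟨*⟩ ≤⇒0≤- (2^a≤3/2^b a b 2a≤b) ⟨+⟩ 0≤a/b 1 4 ⟨*⟩ ≤-trans 0≤1 (1≤x^ (≤-from (0≤a/b 1 2) refl) b))
  (lem (2ℚ ^ a) ((+ 3 / 2) ^ b))
  where
  lem : ∀ x y → (+ 3 / 2) * ((+ 3 / 2) * y) ≡ (+ 2 / 1) * x + ((+ 2 / 1) * (y - x) + (+ 1 / 4) * y)
  lem = solve-∀ ℚ-ring

-- If s < ½ then 2^s ≤ 3/2, whereas d ≤ 2^(3/2) would give 9 ≤ d² ≤ 8.
loglog⇒½≤ : ∀ {d s} → ι 3 ≤ d → loglog d ≤ s → ½ ≤ s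
loglog⇒½≤ {d} {s} 3≤d (0≤s , bound) with ½ ≤? s
... | yes ½≤s = ½≤s
... | no  ½≰s = contradiction (begin-strict
  ι 8               <⟨ ι8<9 ⟩
  ι 9               ≤⟨ ≤-from (3≤ ⟨*⟩ 3≤ ⟨+⟩ 0≤ι 6 ⟨*⟩ 3≤) (lem d) ⟩
  d * (d * 1ℚ)      ≤⟨ bound 2<d (+ 3 / 2) (0≤a/b 3 2) (2^a≤3/2^b ℤ.∣ ↥ s ∣ (↧ₙ s) (ℤₚ.drop‿+≤+ (ℤₚ.<⇒≤ 2a<b))) ⟩
  ι 8               ∎) (<-irrefl refl)
  where
  open ≤-Reasoning
  3≤ = ≤⇒0≤- 3≤d
  ι8<9 : ι 8 < ι 9
  ι8<9 = *<* (ℤ.+<+ (ℕₚ.n<1+n 8))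
  2<d : 2ℚ < d
  2<d = <-≤-trans (*<* (ℤ.+<+ (ℕₚ.n<1+n 2))) 3≤d
  lem : ∀ d → d * (d * 1ℚ) ≡ (+ 9 / 1) + ((d - (+ 3 / 1)) * (d - (+ 3 / 1)) + (+ 6 / 1) * (d - (+ 3 / 1)))
  lem = solve-∀ ℚ-ring
  2a<b : + (ℤ.∣ ↥ s ∣ ℕ.* 2) ℤ.< + (↧ₙ s)
  2a<b = subst₂ ℤ._<_ (trans (cong (ℤ._* + 2) (sym (ℤₚ.0≤i⇒+∣i∣≡i 0≤↥s))) (sym (ℤₚ.pos-* ℤ.∣ ↥ s ∣ 2)))
    (ℤₚ.*-identityˡ (+ (↧ₙ s))) (drop-*<* (≰⇒> ½≰s))
    where
    0≤↥s : ℤ.0ℤ ℤ.≤ ↥ s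
    0≤↥s = subst₂ ℤ._≤_ (ℤₚ.*-zeroˡ (+ (↧ₙ s))) (ℤₚ.*-identityʳ (↥ s)) (drop-*≤* 0≤s)

-- From small deviations to the quotient.

square-bound : ∀ {x κ} → 0ℚ ≤ κ → ¬ (κ * κ ≤ x * x) → x ≤ κ
square-bound {x} {κ} 0≤κ κ²≰x² with ≤-total x κ
... | inj₁ x≤κ = x≤κ
... | inj₂ κ≤x = contradiction
  (≤-from (≤⇒0≤- κ≤x ⟨*⟩ (≤-trans 0≤κ κ≤x ⟨+⟩ 0≤κ)) (lem x κ)) κ²≰x²
  where
  lem : ∀ x κ → x * x ≡ κ * κ + (x - κ) * (x + κ)
  lem = solve-∀ ℚ-ring

square-bound⁻ : ∀ {x κ} → 0ℚ ≤ κ → ¬ (κ * κ ≤ x * x) → 0ℚ ≤ x + κ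
square-bound⁻ {x} {κ} 0≤κ κ²≰x² = subst (0ℚ ≤_) (lem₂ x κ)
  (≤⇒0≤- (square-bound 0≤κ (λ κ²≤ → κ²≰x² (subst (κ * κ ≤_) (lem₁ x) κ²≤))))
  where
  lem₁ : ∀ x → (- x) * (- x) ≡ x * x
  lem₁ = solve-∀ ℚ-ring
  lem₂ : ∀ x κ → κ - (- x) ≡ x + κ
  lem₂ = solve-∀ ℚ-ring

-- If a and b are within κ of 3 κ K, then b / a is within a factor 1 ± 1 / K of 1.
quotient-bounds : ∀ {a b k κ K} → k ≡ ι 3 * (κ * K) → 0ℚ ≤ κ → 1ℚ ≤ K →
  ¬ (κ * κ ≤ (a - k) * (a - k) + (b - k) * (b - k)) →
  (0ℚ ≤ K * b - (K - 1ℚ) * a) × (0ℚ ≤ (K + 1ℚ) * a - K * b) × ι 2 * κ ≤ a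
quotient-bounds {a} {b} {_} {κ} {K} refl 0≤κ 1≤K close =
    -- In the worst case the two differences are `k - (2 K - 1) κ` and `k - (2 K + 1) κ`,
    -- nonnegative because `k = 3 κ K`. The third component serves to exclude `N₁ = 0`.
    subst (0ℚ ≤_) (sym (lem₁ a b κ K)) (0≤K ⟨*⟩ b≥ ⟨+⟩ 0≤K-1 ⟨*⟩ a≤ ⟨+⟩ (0≤κ ⟨*⟩ 0≤K ⟨+⟩ 0≤κ))
  , subst (0ℚ ≤_) (sym (lem₂ a b κ K)) ((0≤K ⟨+⟩ 0≤1) ⟨*⟩ a≥ ⟨+⟩ 0≤K ⟨*⟩ b≤ ⟨+⟩ 0≤κ ⟨*⟩ 0≤K-1)
  , ≤-from (a≥ ⟨+⟩ 0≤ι 3 ⟨*⟩ (0≤κ ⟨*⟩ 0≤K-1)) (lem₃ a κ K)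
  where
  x = a - ι 3 * (κ * K)
  y = b - ι 3 * (κ * K)
  0≤K = ≤-trans 0≤1 1≤K
  0≤K-1 = ≤⇒0≤- 1≤K
  κ²≰x² : ¬ (κ * κ ≤ x * x)
  κ²≰x² κ²≤x² = close (≤-from (≤⇒0≤- κ²≤x² ⟨+⟩ 0≤sq y) (lem (κ * κ) (x * x) (y * y)))
    where
    lem : ∀ κ x y → x + y ≡ κ + (x - κ + y)
    lem = solve-∀ ℚ-ring
  κ²≰y² : ¬ (κ * κ ≤ y * y)
  κ²≰y² κ²≤y² = close (≤-from (≤⇒0≤- κ²≤y² ⟨+⟩ 0≤sq x) (lem (κ * κ) (x * x) (y * y)))
    where
    lem : ∀ κ x y → x + y ≡ κ + (y - κ + x)
    lem = solve-∀ ℚ-ring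
  a≤ = ≤⇒0≤- (square-bound {x} 0≤κ κ²≰x²)
  b≤ = ≤⇒0≤- (square-bound {y} 0≤κ κ²≰y²)
  a≥ = square-bound⁻ {x} 0≤κ κ²≰x²
  b≥ = square-bound⁻ {y} 0≤κ κ²≰y²
  lem₁ : ∀ a b κ K → K * b - (K - 1ℚ) * a ≡
    K * (b - (+ 3 / 1) * (κ * K) + κ) + (K - 1ℚ) * (κ - (a - (+ 3 / 1) * (κ * K))) + (κ * K + κ)
  lem₁ = solve-∀ ℚ-ring
  lem₂ : ∀ a b κ K → (K + 1ℚ) * a - K * b ≡
    (K + 1ℚ) * (a - (+ 3 / 1) * (κ * K) + κ) + K * (κ - (b - (+ 3 / 1) * (κ * K))) + κ * (K - 1ℚ)
  lem₂ = solve-∀ ℚ-ring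
  lem₃ : ∀ a κ K → a ≡ (+ 2 / 1) * κ + (a - (+ 3 / 1) * (κ * K) + κ + (+ 3 / 1) * (κ * (K - 1ℚ)))
  lem₃ = solve-∀ ℚ-ring

T-⌊⌋ : ∀ {P : Set} (P? : Dec P) → T ⌊ P? ⌋ → P
T-⌊⌋ (yes p) _ = p

⌊⌋-false : ∀ {P : Set} (P? : Dec P) → ⌊ P? ⌋ ≡ false → ¬ P
⌊⌋-false (no ¬p) _ = ¬p

-- The tolerated deviation from `k = successes K = 3 κ K`. The variance bounds of the two phases add
-- up to `2 k = 6 κ K`, and the constant 36 makes this `κ² / 6`.
κ : ℕ → ℕ
κ K = 36 ℕ.* K

successes : ℕ → ℕ
successes K = 3 ℕ.* (κ K ℕ.* K)

ι-successes : ∀ K → ι (successes K) ≡ ι 3 * (ι (κ K) * ι K)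
ι-successes K = trans (ι-* 3 (κ K ℕ.* K)) (cong (ι 3 *_) (ι-* (κ K) K))

-- Success probability at relative precision `1 / K`.

module Analysis (K′ : ℕ) (G : Graph) (m≢0 : NonZero (m G)) where
  open Sampling G m≢0

  K k : ℕ
  K = suc K′
  k = successes K

  d : ℚ
  d = averageDegree G m≢0

  instance
    κ-NonZero : NonZero (κ K)
    κ-NonZero = ℕₚ.m*n≢0 36 K

    k-NonZero : NonZero k
    k-NonZero = ℕₚ.m*n≢0 3 (κ K ℕ.* K) {{_}} {{ℕₚ.m*n≢0 (κ K) K}}

  -- The starting potential for `w = 0`, that is, its running-time part.
  start-cost : ℚ
  start-cost = 1ℚ + ι 2 * (ι k * (c₁ + c₂))

  -- Relative error `1 / K` with denominators cleared: a decidable event standing in for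
  -- `Approximates`, whose ε is a real.
  Close : ℚ → Set
  Close x = (K⁻ * d ≤ ι K * x) × (ι K * x ≤ K⁺ * d)
    where
    K⁻ = ι K - 1ℚ
    K⁺ = ι K + 1ℚ

  close? : ∀ x → Dec (Close x)
  close? x = (_ ≤? _) ×-dec (_ ≤? _)

  close⇒approximates : ∀ {ε} → (∀ q → ε ᴿ≤ q → 1ℚ ≤ ι K * q) → ∀ {x} → Close x → Approximates ε d x
  close⇒approximates lower {x} (l , u) q ε≤q =
      cancel (subst (0ℚ ≤_) (lem₁ (ι K) q d x) (≤⇒0≤- l ⟨+⟩ slack))
    , cancel (subst (0ℚ ≤_) (lem₂ (ι K) q d x) (≤⇒0≤- u ⟨+⟩ slack))
    where
    slack : 0ℚ ≤ (ι K * q - 1ℚ) * d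
    slack = ≤⇒0≤- (lower q ε≤q) ⟨*⟩ 0≤a/b (2 ℕ.* m G) (n G)
    cancel : ∀ {p q} → 0ℚ ≤ ι K * (q - p) → p ≤ q
    cancel h = 0≤-⇒≤ (*-cancelˡ-0≤ (0<ι K) h)
    lem₁ : ∀ k q d x → k * x - (k - 1ℚ) * d + (k * q - 1ℚ) * d ≡ k * (x - (1ℚ - q) * d)
    lem₁ = solve-∀ ℚ-ring
    lem₂ : ∀ k q d x → (k + 1ℚ) * d - k * x + (k * q - 1ℚ) * d ≡ k * ((1ℚ + q) * d - x)
    lem₂ = solve-∀ ℚ-ring

  deviation : ℚ → ℕ → ℚ
  deviation p N = (p * ι N - ι k) * (p * ι N - ι k)

  -- Both sides of Close are multiplied by p₂ N₁, since d p₂ = p₁ and x N₁ = N₂.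
  close-ratio : ∀ N₁ N₂ → ¬ (ι (κ K) * ι (κ K) ≤ deviation p₁ N₁ + deviation p₂ N₂) → Close (ratio N₂ N₁)
  -- A small deviation forces `p₁ N₁ ≥ 2 κ > 0`.
  close-ratio zero N₂ small =
    contradiction (≤-trans (proj₂ (proj₂ (quotient-bounds {p₁ * ι 0} {p₂ * ι N₂} {K = ι K} (ι-successes K) (0≤ι (κ K)) (1≤ι K) small))) (≤-reflexive (*-zeroʳ p₁)))
      (λ h → <-irrefl refl (<-≤-trans 0<2κ h))
    where
    0<2κ : 0ℚ < ι 2 * ι (κ K)
    0<2κ = subst (0ℚ <_) (ι-* 2 (κ K)) (0<ι (2 ℕ.* κ K) {{ℕₚ.m*n≢0 2 (κ K)}})
  close-ratio N₁@(suc _) N₂ small =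
      cancel (subst (0ℚ ≤_) lower (proj₁ bounds))
    , cancel (subst (0ℚ ≤_) upper (proj₁ (proj₂ bounds)))
    where
    x = ratio N₂ N₁
    bounds = quotient-bounds {p₁ * ι N₁} {p₂ * ι N₂} {K = ι K} (ι-successes K) (0≤ι (κ K)) (1≤ι K) small
    0<p₂N₁ : 0ℚ < p₂ * ι N₁
    0<p₂N₁ = positive⁻¹ (p₂ * ι N₁) {{pos*pos⇒pos p₂ {{positive 0<p₂}} (ι N₁) {{positive (0<ι N₁)}}}}
    cancel : ∀ {p q} → 0ℚ ≤ (p₂ * ι N₁) * (q - p) → p ≤ q
    cancel h = 0≤-⇒≤ (*-cancelˡ-0≤ 0<p₂N₁ h)
    p₁N₁ : p₁ * ι N₁ ≡ d * p₂ * ι N₁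
    p₁N₁ = cong (_* ι N₁) (sym d*p₂)
    p₂N₂ : p₂ * ι N₂ ≡ p₂ * (x * ι N₁)
    p₂N₂ = cong (p₂ *_) (sym (/-*-ι N₂ N₁))
    lower : ι K * (p₂ * ι N₂) - (ι K - 1ℚ) * (p₁ * ι N₁) ≡ p₂ * ι N₁ * (ι K * x - (ι K - 1ℚ) * d)
    lower = trans (cong₂ (λ a b → ι K * b - (ι K - 1ℚ) * a) p₁N₁ p₂N₂) (lem (ι K) p₂ x (ι N₁) d)
      where
      lem : ∀ k p x n d → k * (p * (x * n)) - (k - 1ℚ) * (d * p * n) ≡ p * n * (k * x - (k - 1ℚ) * d)
      lem = solve-∀ ℚ-ring
    upper : (ι K + 1ℚ) * (p₁ * ι N₁) - ι K * (p₂ * ι N₂) ≡ p₂ * ι N₁ * ((ι K + 1ℚ) * d - ι K * x)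
    upper = trans (cong₂ (λ a b → (ι K + 1ℚ) * a - ι K * b) p₁N₁ p₂N₂) (lem (ι K) p₂ x (ι N₁) d)
      where
      lem : ∀ k p x n d → (k + 1ℚ) * (d * p * n) - k * (p * (x * n)) ≡ p * n * ((k + 1ℚ) * d - k * x)
      lem = solve-∀ ℚ-ring

  start-potential : ∀ w → 1ℚ + (phase w (ι k) p₁ c₁ k 0 + phase w (ι k) p₂ c₂ k 0) ≡ ι 2 * (w * ι k) + start-cost
  start-potential w = trans
    (cong₂ (λ x y → 1ℚ + (x + y)) (phase-start w p₁ c₁ k) (phase-start w p₂ c₂ k))
    (lem w (ι k) c₁ c₂)
    where
    lem : ∀ w k c c′ → 1ℚ + (w * k + (+ 2 / 1) * (k * c) + (w * k + (+ 2 / 1) * (k * c′))) ≡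
      (+ 2 / 1) * (w * k) + (1ℚ + (+ 2 / 1) * (k * (c + c′)))
    lem = solve-∀ ℚ-ring

  -- For the query count alone, every value is declared good and the deviation gets weight 0.
  queries≤start-cost : ExpectedQueries≤ G (ratioEstimator k) start-cost
  queries≤start-cost t = ≤-trans
    (Drift.queries≤ G m≢0 (ratioEstimator k) (λ _ → true) 0 potential potential-nonNeg
      (drift (λ _ → true) 0 (λ _ _ ())) t (vertexTrial {[]} k 0))
    (≤-reflexive (trans (start-potential 0ℚ) (lem (ι k) start-cost)))
    where
    open Estimator k G m≢0 {0ℚ} ≤-refl
    lem : ∀ k c → (+ 2 / 1) * (0ℚ * k) + c ≡ c
    lem = solve-∀ ℚ-ring

  -- With weight W the penalty for a bad value is B = W κ². The initial
  -- deviations account for 2 W k = B / 6 of the potential, the running time for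
  -- at most another B / 6.
  W B : ℕ
  W = 6 ℕ.* suc (2 ℕ.* (k ℕ.* (n G ℕ.+ 2 ℕ.* m G)))
  B = W ℕ.* (κ K ℕ.* κ K)

  instance
    κ²-NonZero : NonZero (κ K ℕ.* κ K)
    κ²-NonZero = ℕₚ.m*n≢0 (κ K) (κ K)

    B-NonZero : NonZero B
    B-NonZero = ℕₚ.m*n≢0 W (κ K ℕ.* κ K)

  ι-B : ι B ≡ ι W * (ι (κ K) * ι (κ K))
  ι-B = trans (ι-* W (κ K ℕ.* κ K)) (cong (ι W *_) (ι-* (κ K) (κ K)))

  a/n′≤a : ∀ a → + a / n′ G ≤ ι a
  a/n′≤a a = ≤-from (0≤a/b a (n′ G) ⟨*⟩ ≤⇒0≤- (1≤ι (n′ G)))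
    (trans (sym (/-*-ι a (n′ G))) (lem (+ a / n′ G) (ι (n′ G))))
    where
    lem : ∀ c n → c * n ≡ c + c * (n - 1ℚ)
    lem = solve-∀ ℚ-ring

  -- `c₁ ≤ n` and `c₂ ≤ 2 m` hold because `n′ ≥ 1`. Such crude bounds are harmless: `W` and `B`
  -- occur only in the analysis, not in the algorithm.
  6*start-cost≤B : ι 6 * start-cost ≤ ι B
  6*start-cost≤B = begin
    ι 6 * start-cost
      ≤⟨ ≤-from (0≤ι 12 ⟨*⟩ (0≤ι k ⟨*⟩ (≤⇒0≤- (a/n′≤a (n G)) ⟨+⟩ ≤⇒0≤- (a/n′≤a (2 ℕ.* m G)))))
           (lem (ι k) c₁ c₂ (ι (n G)) (ι (2 ℕ.* m G))) ⟩
    ι 6 * (1ℚ + ι 2 * (ι k * (ι (n G) + ι (2 ℕ.* m G))))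
      ≡⟨ ι-W ⟨
    ι W
      ≤⟨ ι-mono (ℕₚ.m≤m*n W (κ K ℕ.* κ K)) ⟩
    ι B ∎
    where
    open ≤-Reasoning
    lem : ∀ k c c′ x x′ → (+ 6 / 1) * (1ℚ + (+ 2 / 1) * (k * (x + x′))) ≡
      (+ 6 / 1) * (1ℚ + (+ 2 / 1) * (k * (c + c′))) + (+ 12 / 1) * (k * (x - c + (x′ - c′)))
    lem = solve-∀ ℚ-ring
    ι-W : ι W ≡ ι 6 * (1ℚ + ι 2 * (ι k * (ι (n G) + ι (2 ℕ.* m G))))
    ι-W = trans (ι-* 6 (suc (2 ℕ.* (k ℕ.* (n G ℕ.+ 2 ℕ.* m G))))) (cong (ι 6 *_)
      (trans (ι-suc (2 ℕ.* (k ℕ.* (n G ℕ.+ 2 ℕ.* m G)))) (cong (λ z → 1ℚ + z)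
      (trans (ι-* 2 (k ℕ.* (n G ℕ.+ 2 ℕ.* m G))) (cong (ι 2 *_)
      (trans (ι-* k (n G ℕ.+ 2 ℕ.* m G)) (cong (ι k *_) (ι-+ (n G) (2 ℕ.* m G)))))))))

  good : ℚ → Bool
  good x = ⌊ close? x ⌋

  -- The contrapositive of `close-ratio` scaled by `W`; it is constructive since `≤` on rationals is
  -- decidable.
  bad⇒deviation : ∀ N₁ N₂ → good (ratio N₂ N₁) ≡ false →
    ι B ≤ phase (ι W) (ι k) p₁ c₁ 0 N₁ + phase (ι W) (ι k) p₂ c₂ 0 N₂
  bad⇒deviation N₁ N₂ bad = begin
    ι B                                                   ≡⟨ ι-B ⟩
    ι W * (ι (κ K) * ι (κ K))
      ≤⟨ *-monoˡ-≤-nonNeg (ι W) {{nonNegative (0≤ι W)}} (decidable-stable (_ ≤? _) λ small →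
           ⌊⌋-false (close? (ratio N₂ N₁)) bad (close-ratio N₁ N₂ small)) ⟩
    ι W * (deviation p₁ N₁ + deviation p₂ N₂)             ≡⟨ *-distribˡ-+ (ι W) (deviation p₁ N₁) (deviation p₂ N₂) ⟩
    ι W * deviation p₁ N₁ + ι W * deviation p₂ N₂
      ≡⟨ cong₂ _+_ (phase-end (ι W) (ι k) p₁ c₁ N₁) (phase-end (ι W) (ι k) p₂ c₂ N₂) ⟨
    phase (ι W) (ι k) p₁ c₁ 0 N₁ + phase (ι W) (ι k) p₂ c₂ 0 N₂ ∎
    where open ≤-Reasoning

  -- `prob≥` at `t = B` reads `B ≤ B / 6 + start-cost + prob * B`, and `start-cost ≤ B / 6`.
  success-probability : + 2 / 3 ≤ Run.prob G (ratioEstimator k) good B (vertexTrial {[]} k 0)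
  success-probability = 0≤-⇒≤ (*-cancelˡ-0≤ (0<ι B) (subst (0ℚ ≤_) eq
      (≤⇒0≤- B≤ ⟨+⟩ 0≤a/b 1 6 ⟨*⟩ ≤⇒0≤- 6*start-cost≤B)))
    where
    open Estimator k G m≢0 {ι W} (0≤ι W)
    prob = Run.prob G (ratioEstimator k) good B (vertexTrial {[]} k 0)
    B≤ : ι B ≤ ι 2 * (ι W * ι k) + start-cost + prob * ι B
    B≤ = subst (λ z → ι B ≤ z + prob * ι B) (start-potential (ι W))
      (Drift.prob≥ G m≢0 (ratioEstimator k) good B potential potential-nonNeg
        (drift good B bad⇒deviation) B (vertexTrial {[]} k 0) ℕₚ.≤-refl)
    2Wk≡B/6 : ι 2 * (ι W * ι k) ≡ (+ 1 / 6) * ι B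
    2Wk≡B/6 = begin
      ι 2 * (ι W * ι k)                         ≡⟨ cong (λ z → ι 2 * (ι W * z)) (ι-successes K) ⟩
      ι 2 * (ι W * (ι 3 * (ι (κ K) * ι K)))     ≡⟨ lem (ι W) (ι (κ K)) (ι K) ⟩
      (+ 1 / 6) * (ι W * (ι (κ K) * (ι 36 * ι K))) ≡⟨ cong (λ z → (+ 1 / 6) * (ι W * (ι (κ K) * z))) (ι-* 36 K) ⟨
      (+ 1 / 6) * (ι W * (ι (κ K) * ι (κ K)))   ≡⟨ cong ((+ 1 / 6) *_) ι-B ⟨
      (+ 1 / 6) * ι B                           ∎
      where
      open ≡-Reasoning
      lem : ∀ w κ k → (+ 2 / 1) * (w * ((+ 3 / 1) * (κ * k))) ≡ (+ 1 / 6) * (w * (κ * ((+ 36 / 1) * k)))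
      lem = solve-∀ ℚ-ring
    eq : ι 2 * (ι W * ι k) + start-cost + prob * ι B - ι B + (+ 1 / 6) * (ι B - ι 6 * start-cost) ≡
      ι B * (prob - + 2 / 3)
    eq = trans (cong (λ z → z + start-cost + prob * ι B - ι B + (+ 1 / 6) * (ι B - ι 6 * start-cost)) 2Wk≡B/6)
      (lem (ι B) prob start-cost)
      where
      lem : ∀ b p c → (+ 1 / 6) * b + c + p * b - b + (+ 1 / 6) * (b - (+ 6 / 1) * c) ≡ b * (p - + 2 / 3)
      lem = solve-∀ ℚ-ring

  returns : ∀ ε → (∀ q → ε ᴿ≤ q → 1ℚ ≤ ι K * q) →
    ReturnsWithProbability≥ G (ratioEstimator k) (+ 2 / 3) (Approximates ε d)
  returns ε lower =
      good
    , (λ x good-x → close⇒approximates {ε} lower (T-⌊⌋ (close? x) good-x))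
    -- The probability `2/3` is already reached after `B` steps, so one `t` serves every `δ`.
    , (λ δ 0<δ → B , ≤-trans (≤-from (<⇒≤ 0<δ) (lem (+ 2 / 3) δ)) success-probability)
    where
    lem : ∀ p δ → p ≡ p - δ + δ
    lem = solve-∀ ℚ-ring

  -- The query bound.

  μ : ℚ
  μ = + m G / n′ G

  c₂≡2μ : c₂ ≡ ι 2 * μ
  c₂≡2μ = *-cancelˡ-pos (0<ι (n′ G)) (begin
    ι (n′ G) * c₂          ≡⟨ trans (*-comm (ι (n′ G)) c₂) (/-*-ι (2 ℕ.* m G) (n′ G)) ⟩
    ι (2 ℕ.* m G)          ≡⟨ ι-* 2 (m G) ⟩
    ι 2 * ι (m G)          ≡⟨ cong (ι 2 *_) (/-*-ι (m G) (n′ G)) ⟨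
    ι 2 * (μ * ι (n′ G))   ≡⟨ lem μ (ι (n′ G)) ⟩
    ι (n′ G) * (ι 2 * μ)   ∎)
    where
    open ≡-Reasoning
    lem : ∀ μ n → (+ 2 / 1) * (μ * n) ≡ n * ((+ 2 / 1) * μ)
    lem = solve-∀ ℚ-ring

  -- This is `d * p₂ ≡ p₁` after passing to reciprocals.
  d*c₁ : d * c₁ ≡ c₂
  d*c₁ = begin
    d * c₁               ≡⟨ *-identityʳ (d * c₁) ⟨
    d * c₁ * 1ℚ          ≡⟨ cong (d * c₁ *_) p₂*c₂ ⟨
    d * c₁ * (p₂ * c₂)   ≡⟨ lem d c₁ p₂ c₂ ⟩
    d * p₂ * c₁ * c₂     ≡⟨ cong (λ z → z * c₁ * c₂) d*p₂ ⟩
    p₁ * c₁ * c₂         ≡⟨ cong (_* c₂) p₁*c₁ ⟩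
    1ℚ * c₂              ≡⟨ *-identityˡ c₂ ⟩
    c₂                   ∎
    where
    open ≡-Reasoning
    lem : ∀ d c p c′ → d * c * (p * c′) ≡ d * p * c * c′
    lem = solve-∀ ℚ-ring

  -- For `d ≥ 3`, `s ≥ ½` gives `c₂ = 2 μ ≤ 4 μ s`; otherwise `c₂ = d c₁ ≤ 3 c₁`.
  c₁+c₂≤ : ∀ {s} → loglog d ≤ s → c₁ + c₂ ≤ ι 4 * (μ * s + c₁)
  c₁+c₂≤ {s} loglog≤s = by-cases (ι 3 ≤? d)
    where
    0≤μ : 0ℚ ≤ μ
    0≤μ = 0≤a/b (m G) (n′ G)
    0≤c₁ : 0ℚ ≤ c₁
    0≤c₁ = 0≤a/b (n G) (n′ G)
    by-cases : Dec (ι 3 ≤ d) → c₁ + c₂ ≤ ι 4 * (μ * s + c₁)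
    by-cases (yes 3≤d) = ≤-from (0≤ι 4 ⟨*⟩ (0≤μ ⟨*⟩ ≤⇒0≤- (loglog⇒½≤ 3≤d loglog≤s)) ⟨+⟩ 0≤ι 3 ⟨*⟩ 0≤c₁)
      (trans (lem μ s c₁) (cong (λ z → c₁ + z + (ι 4 * (μ * (s - ½)) + ι 3 * c₁)) (sym c₂≡2μ)))
      where
      lem : ∀ μ s c → (+ 4 / 1) * (μ * s + c) ≡
        c + (+ 2 / 1) * μ + ((+ 4 / 1) * (μ * (s - ½)) + (+ 3 / 1) * c)
      lem = solve-∀ ℚ-ring
    by-cases (no 3≰d) = ≤-from (0≤ι 4 ⟨*⟩ (0≤μ ⟨*⟩ proj₁ loglog≤s) ⟨+⟩ ≤⇒0≤- (<⇒≤ (≰⇒> 3≰d)) ⟨*⟩ 0≤c₁)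
      (trans (lem μ s c₁ d) (cong (λ z → c₁ + z + (ι 4 * (μ * s) + (ι 3 - d) * c₁)) d*c₁))
      where
      lem : ∀ μ s c d → (+ 4 / 1) * (μ * s + c) ≡
        c + d * c + ((+ 4 / 1) * (μ * s) + ((+ 3 / 1) - d) * c)
      lem = solve-∀ ℚ-ring

  -- As `k` and `c₁` are at least 1, the cost is at most `3 k (c₁ + c₂)` with `k = 108 K²`. Then
  -- `K ≤ 4 i` contributes `4²` and `c₁+c₂≤` another 4: `20736 = 324 * 16 * 4`.
  start-cost≤ : ∀ {s i} → loglog d ≤ s → ι K ≤ ι 4 * i →
    start-cost ≤ ι 20736 * (μ * s * i * i + c₁ * i * i)
  start-cost≤ {s} {i} loglog≤s K≤4i = begin
    start-cost
      ≤⟨ ≤-from (0≤k ⟨*⟩ ≤⇒0≤- c₁≥1 ⟨+⟩ ≤⇒0≤- (1≤ι k) ⟨+⟩ 0≤k ⟨*⟩ 0≤a/b (2 ℕ.* m G) (n′ G)) (lem₁ (ι k) c₁ c₂) ⟩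
    ι 3 * (ι k * (c₁ + c₂))
      ≡⟨ cong (λ z → ι 3 * (z * (c₁ + c₂))) (trans (ι-successes K) (cong (λ z → ι 3 * (z * ι K)) (ι-* 36 K))) ⟩
    ι 3 * (ι 3 * (ι 36 * ι K * ι K) * (c₁ + c₂))
      ≤⟨ ≤-from (0≤ι 324 ⟨*⟩ ((≤⇒0≤- K≤4i ⟨*⟩ (0≤4i ⟨+⟩ 0≤ι K)) ⟨*⟩ 0≤S)) (lem₂ (ι K) i (c₁ + c₂)) ⟩
    ι 324 * (ι 4 * i * (ι 4 * i) * (c₁ + c₂))
      ≤⟨ ≤-from (0≤ι 324 ⟨*⟩ (0≤4i ⟨*⟩ 0≤4i ⟨*⟩ ≤⇒0≤- (c₁+c₂≤ loglog≤s))) (lem₃ i (c₁ + c₂) (ι 4 * (μ * s + c₁))) ⟩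
    ι 324 * (ι 4 * i * (ι 4 * i) * (ι 4 * (μ * s + c₁)))
      ≡⟨ lem₄ i μ s c₁ ⟩
    ι 20736 * (μ * s * i * i + c₁ * i * i) ∎
    where
    open ≤-Reasoning
    0≤k : 0ℚ ≤ ι k
    0≤k = 0≤ι k
    0≤4i : 0ℚ ≤ ι 4 * i
    0≤4i = ≤-trans (0≤ι K) K≤4i
    0≤S : 0ℚ ≤ c₁ + c₂
    0≤S = 0≤a/b (n G) (n′ G) ⟨+⟩ 0≤a/b (2 ℕ.* m G) (n′ G)
    lem₁ : ∀ k c c′ → (+ 3 / 1) * (k * (c + c′)) ≡
      1ℚ + (+ 2 / 1) * (k * (c + c′)) + (k * (c - 1ℚ) + (k - 1ℚ) + k * c′)
    lem₁ = solve-∀ ℚ-ring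
    lem₂ : ∀ k i S → (+ 324 / 1) * ((+ 4 / 1) * i * ((+ 4 / 1) * i) * S) ≡
      (+ 3 / 1) * ((+ 3 / 1) * ((+ 36 / 1) * k * k) * S) +
      (+ 324 / 1) * (((+ 4 / 1) * i - k) * ((+ 4 / 1) * i + k) * S)
    lem₂ = solve-∀ ℚ-ring
    lem₃ : ∀ i S T → (+ 324 / 1) * ((+ 4 / 1) * i * ((+ 4 / 1) * i) * T) ≡
      (+ 324 / 1) * ((+ 4 / 1) * i * ((+ 4 / 1) * i) * S) +
      (+ 324 / 1) * ((+ 4 / 1) * i * ((+ 4 / 1) * i) * (T - S))
    lem₃ = solve-∀ ℚ-ring
    lem₄ : ∀ i μ s c → (+ 324 / 1) * ((+ 4 / 1) * i * ((+ 4 / 1) * i) * ((+ 4 / 1) * (μ * s + c))) ≡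
      (+ 20736 / 1) * (μ * s * i * i + c * i * i)
    lem₄ = solve-∀ ℚ-ring

  queries≤ : ∀ {ε} → (∀ q → q ≤ᴿ ε → ι K * q ≤ ι 4) →
    ∀ s q → loglog d ≤ s → (q>0 : Positive q) → q ≤ᴿ ε →
    ExpectedQueries≤ G (ratioEstimator k) (queryBound G m≢0 20736 s q q>0)
  queries≤ upper s q loglog≤s q>0 q≤ε t = ≤-trans (queries≤start-cost t)
    (start-cost≤ loglog≤s (≤-from (≤⇒0≤- (upper q q≤ε) ⟨*⟩ 0≤i) eq))
    where
    -- Division in `queryBound` unfolds to multiplication by this reciprocal, and `K q ≤ 4` becomes
    -- `K ≤ 4 i`.
    i = (1/ q) {{pos⇒nonZero q {{q>0}}}}
    0≤i : 0ℚ ≤ i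
    0≤i = <⇒≤ (positive⁻¹ i {{1/pos⇒pos q {{q>0}}}})
    eq : ι 4 * i ≡ ι K + (ι 4 - ι K * q) * i
    eq = begin
      ι 4 * i                              ≡⟨ lem (ι K) q i ⟩
      ι K * (q * i) + (ι 4 - ι K * q) * i  ≡⟨ cong (λ z → ι K * z + (ι 4 - ι K * q) * i) (*-inverseʳ q {{pos⇒nonZero q {{q>0}}}}) ⟩
      ι K * 1ℚ + (ι 4 - ι K * q) * i       ≡⟨ cong (_+ (ι 4 - ι K * q) * i) (*-identityʳ (ι K)) ⟩
      ι K + (ι 4 - ι K * q) * i            ∎
      where
      open ≡-Reasoning
      lem : ∀ k q i → (+ 4 / 1) * i ≡ k * (q * i) + ((+ 4 / 1) - k * q) * i
      lem = solve-∀ ℚ-ring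

theorem20 : Σ ℕ λ C →
    Σ ((ε : ℝ) → 0ℚ <ᴿ ε → ε ᴿ< 1ℚ → Algorithm) λ A →
    (ε : ℝ) (0<ε : 0ℚ <ᴿ ε) (ε<1 : ε ᴿ< 1ℚ) →
    (G : Graph) (m≢0 : NonZero (m G)) →
    ReturnsWithProbability≥ G (A ε 0<ε ε<1) (+ 2 / 3)
    (Approximates ε (averageDegree G m≢0))
    ×
    ((s q : ℚ) → loglog (averageDegree G m≢0) ≤ s → (q>0 : Positive q) → q ≤ᴿ ε →
    ExpectedQueries≤ G (A ε 0<ε ε<1) (queryBound G m≢0 C s q q>0))
theorem20 = 20736
  -- The number of successes to wait for is computed from ε alone, before any graph is given.
  , (λ ε 0<ε ε<1 → ratioEstimator (successes (suc (proj₁ (calibrate ε 0<ε ε<1)))))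
  , λ ε 0<ε ε<1 G m≢0 → let K , lower , upper = calibrate ε 0<ε ε<1 in
      Analysis.returns K G m≢0 ε lower
    , Analysis.queries≤ K G m≢0 {ε} upper
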